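{- Let $F$ be a simple graph of order $n\ge2$, let $E_k=\{e_1,\ldots,e_k\}\subseteq E(F)$ with $|E_k|=k$, and suppose the subgraph $\mathscr E_k$ of $F$ induced by $E_k$ is $r$-regular; let $p=2k/r$ be its number of vertices. Let $H_{uv}$ be a simple graph of order $m\ge3$ with a specified edge $uv$ such that $u$ and $v$ both have degree $m-1$ in $H_{uv}$. Put $H_2=H_{uv}-\{u,v\}$ and $G=G[F,E_k,H_{uv}]$. Order the vertices of $F$ so that the vertices of $\mathscr E_k$ come first. Then the characteristic polynomial of the signless Laplacian matrix of $G$ is $$f_{Q(G)}(x)=\bigl(f_{Q(H_2)}(x-2)\bigr)^k\det(xI_n-M),$$ $$M=Q(F)+r(m-2)\begin{pmatrix} I_p&0\\0&0\end{pmatrix}+\Gamma_{Q(H_2)}(x-2)\begin{pmatrix}Q(\mathscr E_k)&0\\0&0\end{pmatrix},$$ where the block matrices are $n\times n$.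
   Context: All graphs are finite and simple. $Q(X)=D(X)+A(X)$ is the signless Laplacian matrix of a graph $X$ ($D$ the diagonal degree matrix, $A$ the adjacency matrix). For a square matrix $N$ of order $s$, $f_N(x)=\det(xI_s-N)$ is its characteristic polynomial, and its coronal is $\Gamma_N(x)=\mathbf 1_s^T(xI_s-N)^{ -1}\mathbf 1_s$, a rational function of $x$, where $\mathbf 1_s$ is the all-ones column vector; the identity is an identity of rational functions in $x$. The subgraph induced by an edge set $E_k$ has edge set $E_k$ and vertex set the endpoints of edges in $E_k$. Graph with $k$ edge-pockets: $H_{uv}$ is a graph with a specified edge $uv$ such that $H_{uv}-u\cong H_{uv}-v$ (automatic when $u,v$ both have degree $m-1$). $G[F,E_k,H_{uv}]$ is obtained by taking one copy of $F$ and $k$ vertex-disjoint copies of $H_{uv}$, and, for each $i=1,\ldots,k$, pasting (identifying) the edge $uv$ of the $i$th copy of $H_{uv}$ with the edge $e_i$ of $F$. -}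

module Defs where

open import Algebra.Bundles using (CommutativeRing; Semiring)
import Algebra.Definitions.RawSemiring as RawSemiringDefs
import Algebra.Properties.Ring as RingProperties
import Algebra.Solver.Ring.NaturalCoefficients.Default as SemiringSolver
open import Data.Fin.Base using (Fin; zero; suc; toℕ; _↑ˡ_; _↑ʳ_; splitAt; combine; punchIn; punchOut)
open import Data.Fin.Properties as Fin
  using (_≟_; any?; ↑ˡ-injective; ↑ʳ-injective; splitAt-↑ˡ; splitAt-↑ʳ; combine-injectiveʳ; punchOut-injective)
open import Data.Fin.Subset using (Subset; ∣_∣)
open import Data.List.Base using (List; []; _∷_; map)
open import Data.Nat.Base as ℕ using (ℕ; zero; suc)
open import Data.Product.Base using (∃; ∃₂; _×_; _,_)
open import Data.Rational.Base as ℚ using (ℚ)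
import Data.Rational.Properties as ℚ
open import Data.Sum.Base using (_⊎_; inj₁; inj₂; [_,_]′)
import Data.Sum.Base as Sum
open import Data.Vec.Base using (tabulate)
open import Function.Base using (_∘_; const; _on_)
open import Function.Bundles using (_⇔_)
open import Function.Definitions using (Injective)
open import Level using (Level; 0ℓ; _⊔_)
open import Relation.Binary.Bundles using (Setoid)
open import Relation.Binary.Core using (Rel)
open import Relation.Binary.Definitions using (Decidable; Symmetric; Irreflexive)
open import Relation.Binary.PropositionalEquality
  using (_≡_; _≢_; refl; sym; trans; cong)
import Relation.Binary.Reasoning.Setoid as SetoidReasoning
open import Relation.Binary.Structures using (IsEquivalence)
open import Relation.Nullary.Decidable using (Dec; yes; no; does; map′; _×-dec_; _⊎-dec_)
open import Relation.Nullary.Negation using (¬_; contradiction)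

-- Univariate polynomials: coefficient lists, lowest degree first, compared
-- coefficientwise, so that trailing zeros are irrelevant.

module Polynomials {c ℓ} (R : CommutativeRing c ℓ) where

  private
    module R = CommutativeRing R
    open RingProperties R.ring using (-0#≈0#)
  open R using (Carrier)

  Poly : Set c
  Poly = List Carrier

  coeff : Poly → ℕ → Carrier
  coeff []      _       = R.0#
  coeff (a ∷ p) zero    = a
  coeff (a ∷ p) (suc n) = coeff p n

  infix 4 _≈_
  record _≈_ (p q : Poly) : Set ℓ where
    constructor mk≈
    field coeff-≈ : ∀ n → coeff p n R.≈ coeff q n
  open _≈_ public

  infix  8 -_
  infixl 7 _*_ _·_
  infixl 6 _+_

  _+_ : Poly → Poly → Poly
  []      + q       = q
  (a ∷ p) + []      = a ∷ p
  (a ∷ p) + (b ∷ q) = (a R.+ b) ∷ (p + q)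

  -_ : Poly → Poly
  - p = map (λ a → R.- a) p

  _·_ : Carrier → Poly → Poly
  a · p = map (a R.*_) p

  _*_ : Poly → Poly → Poly
  []      * q = []
  (a ∷ p) * q = a · q + (R.0# ∷ p * q)

  0# 1# X : Poly
  0# = []
  1# = R.1# ∷ []
  X  = R.0# ∷ R.1# ∷ []

  private
    coeff-+ : ∀ p q n → coeff (p + q) n R.≈ coeff p n R.+ coeff q n
    coeff-+ []      q       n       = R.sym (R.+-identityˡ _)
    coeff-+ (a ∷ p) []      n       = R.sym (R.+-identityʳ _)
    coeff-+ (a ∷ p) (b ∷ q) zero    = R.refl
    coeff-+ (a ∷ p) (b ∷ q) (suc n) = coeff-+ p q n

    coeff-neg : ∀ p n → coeff (- p) n R.≈ R.- coeff p n
    coeff-neg []      n       = R.sym -0#≈0#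
    coeff-neg (a ∷ p) zero    = R.refl
    coeff-neg (a ∷ p) (suc n) = coeff-neg p n

    coeff-· : ∀ a p n → coeff (a · p) n R.≈ a R.* coeff p n
    coeff-· a []      n       = R.sym (R.zeroʳ a)
    coeff-· a (b ∷ p) zero    = R.refl
    coeff-· a (b ∷ p) (suc n) = coeff-· a p n

    ≈-refl : ∀ {p} → p ≈ p
    ≈-refl .coeff-≈ n = R.refl

    ≈-sym : ∀ {p q} → p ≈ q → q ≈ p
    ≈-sym e .coeff-≈ n = R.sym (e .coeff-≈ n)

    ≈-trans : ∀ {p q r} → p ≈ q → q ≈ r → p ≈ r
    ≈-trans e f .coeff-≈ n = R.trans (e .coeff-≈ n) (f .coeff-≈ n)

  ≈-isEquivalence : IsEquivalence _≈_
  ≈-isEquivalence = record { refl = ≈-refl ; sym = ≈-sym ; trans = ≈-trans }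

  private
    ≈-setoid : Setoid c ℓ
    ≈-setoid = record { isEquivalence = ≈-isEquivalence }

    open SetoidReasoning ≈-setoid

    ∷-cong : ∀ {a b p q} → a R.≈ b → p ≈ q → (a ∷ p) ≈ (b ∷ q)
    ∷-cong e f .coeff-≈ zero    = e
    ∷-cong e f .coeff-≈ (suc n) = f .coeff-≈ n

    0∷[] : (R.0# ∷ []) ≈ []
    0∷[] .coeff-≈ zero    = R.refl
    0∷[] .coeff-≈ (suc n) = R.refl

    0∷-cong : ∀ {p q} → p ≈ q → (R.0# ∷ p) ≈ (R.0# ∷ q)
    0∷-cong = ∷-cong R.refl

    +-cong : ∀ {p p′ q q′} → p ≈ p′ → q ≈ q′ → p + q ≈ p′ + q′
    +-cong {p} {p′} {q} {q′} e f .coeff-≈ n =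
      R.trans (coeff-+ p q n)
        (R.trans (R.+-cong (e .coeff-≈ n) (f .coeff-≈ n)) (R.sym (coeff-+ p′ q′ n)))

    +-comm : ∀ p q → p + q ≈ q + p
    +-comm p q .coeff-≈ n =
      R.trans (coeff-+ p q n) (R.trans (R.+-comm _ _) (R.sym (coeff-+ q p n)))

    +-assoc : ∀ p q r → (p + q) + r ≈ p + (q + r)
    +-assoc p q r .coeff-≈ n =
      R.trans (R.trans (coeff-+ (p + q) r n) (R.+-congʳ (coeff-+ p q n)))
        (R.trans (R.+-assoc _ _ _)
          (R.sym (R.trans (coeff-+ p (q + r) n) (R.+-congˡ (coeff-+ q r n)))))

    +-identityˡ : ∀ p → 0# + p ≈ p
    +-identityˡ p = ≈-refl

    +-identityʳ : ∀ p → p + 0# ≈ p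
    +-identityʳ p = ≈-trans (+-comm p 0#) ≈-refl

    -‿inverseʳ : ∀ p → p + - p ≈ 0#
    -‿inverseʳ p .coeff-≈ n =
      R.trans (coeff-+ p (- p) n)
        (R.trans (R.+-congˡ (coeff-neg p n)) (R.-‿inverseʳ _))

    -‿inverseˡ : ∀ p → - p + p ≈ 0#
    -‿inverseˡ p = ≈-trans (+-comm (- p) p) (-‿inverseʳ p)

    -‿cong : ∀ {p q} → p ≈ q → - p ≈ - q
    -‿cong {p} {q} e .coeff-≈ n =
      R.trans (coeff-neg p n) (R.trans (R.-‿cong (e .coeff-≈ n)) (R.sym (coeff-neg q n)))

    interchange : ∀ p q r s → (p + q) + (r + s) ≈ (p + r) + (q + s)
    interchange p q r s = begin
      (p + q) + (r + s) ≈⟨ +-assoc p q (r + s) ⟩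
      p + (q + (r + s)) ≈⟨ +-cong (≈-refl {p}) (+-assoc q r s) ⟨
      p + ((q + r) + s) ≈⟨ +-cong (≈-refl {p}) (+-cong (+-comm q r) (≈-refl {s})) ⟩
      p + ((r + q) + s) ≈⟨ +-cong (≈-refl {p}) (+-assoc r q s) ⟩
      p + (r + (q + s)) ≈⟨ +-assoc p r (q + s) ⟨
      (p + r) + (q + s) ∎

    ·-cong : ∀ {a b p q} → a R.≈ b → p ≈ q → a · p ≈ b · q
    ·-cong {a} {b} {p} {q} e f .coeff-≈ n =
      R.trans (coeff-· a p n)
        (R.trans (R.*-cong e (f .coeff-≈ n)) (R.sym (coeff-· b q n)))

    ·-distribˡ : ∀ a p q → a · (p + q) ≈ a · p + a · q
    ·-distribˡ a p q .coeff-≈ n =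
      R.trans (coeff-· a (p + q) n)
        (R.trans (R.*-congˡ (coeff-+ p q n))
          (R.trans (R.distribˡ _ _ _)
            (R.sym (R.trans (coeff-+ (a · p) (a · q) n)
              (R.+-cong (coeff-· a p n) (coeff-· a q n))))))

    ·-distribʳ : ∀ a b p → (a R.+ b) · p ≈ a · p + b · p
    ·-distribʳ a b p .coeff-≈ n =
      R.trans (coeff-· (a R.+ b) p n)
        (R.trans (R.distribʳ _ _ _)
          (R.sym (R.trans (coeff-+ (a · p) (b · p) n)
            (R.+-cong (coeff-· a p n) (coeff-· b p n)))))

    ·-assoc : ∀ a b p → (a R.* b) · p ≈ a · (b · p)
    ·-assoc a b p .coeff-≈ n =
      R.trans (coeff-· (a R.* b) p n)
        (R.trans (R.*-assoc _ _ _)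
          (R.sym (R.trans (coeff-· a (b · p) n) (R.*-congˡ (coeff-· b p n)))))

    1·_ : ∀ p → R.1# · p ≈ p
    (1· p) .coeff-≈ n = R.trans (coeff-· R.1# p n) (R.*-identityˡ _)

    0·_ : ∀ p → R.0# · p ≈ 0#
    (0· p) .coeff-≈ n = R.trans (coeff-· R.0# p n) (R.zeroˡ _)

    0∷-+ : ∀ p q → (R.0# ∷ p + q) ≈ (R.0# ∷ p) + (R.0# ∷ q)
    0∷-+ p q = ∷-cong (R.sym (R.+-identityˡ _)) ≈-refl

    0∷-* : ∀ p q → (R.0# ∷ p) * q ≈ (R.0# ∷ p * q)
    0∷-* p q = +-cong (0· q) (≈-refl {R.0# ∷ p * q})

    *-congˡ : ∀ p {q q′} → q ≈ q′ → p * q ≈ p * q′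
    *-congˡ []      e = ≈-refl
    *-congˡ (a ∷ p) e = +-cong (·-cong R.refl e) (0∷-cong (*-congˡ p e))

    *-zeroʳ : ∀ p → p * 0# ≈ 0#
    *-zeroʳ []      = ≈-refl
    *-zeroʳ (a ∷ p) = ≈-trans (0∷-cong (*-zeroʳ p)) 0∷[]

    *-∷ : ∀ p b q → p * (b ∷ q) ≈ b · p + (R.0# ∷ p * q)
    *-∷ []      b q = ≈-sym 0∷[]
    *-∷ (a ∷ p) b q = ∷-cong (R.+-congʳ (R.*-comm a b)) (begin
      a · q + p * (b ∷ q)              ≈⟨ +-cong (≈-refl {a · q}) (*-∷ p b q) ⟩
      a · q + (b · p + (R.0# ∷ p * q)) ≈⟨ +-assoc (a · q) (b · p) _ ⟨
      (a · q + b · p) + (R.0# ∷ p * q) ≈⟨ +-cong (+-comm (a · q) (b · p)) ≈-refl ⟩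
      (b · p + a · q) + (R.0# ∷ p * q) ≈⟨ +-assoc (b · p) (a · q) _ ⟩
      b · p + (a · q + (R.0# ∷ p * q)) ∎)

    *-comm : ∀ p q → p * q ≈ q * p
    *-comm []      q = ≈-sym (*-zeroʳ q)
    *-comm (a ∷ p) q = begin
      a · q + (R.0# ∷ p * q) ≈⟨ +-cong (≈-refl {a · q}) (0∷-cong (*-comm p q)) ⟩
      a · q + (R.0# ∷ q * p) ≈⟨ *-∷ q a p ⟨
      q * (a ∷ p)            ∎

    *-cong : ∀ {p p′ q q′} → p ≈ p′ → q ≈ q′ → p * q ≈ p′ * q′
    *-cong {p} {p′} {q} {q′} e f = begin
      p * q   ≈⟨ *-congˡ p f ⟩
      p * q′  ≈⟨ *-comm p q′ ⟩
      q′ * p  ≈⟨ *-congˡ q′ e ⟩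
      q′ * p′ ≈⟨ *-comm q′ p′ ⟩
      p′ * q′ ∎

    distribˡ : ∀ p q r → p * (q + r) ≈ p * q + p * r
    distribˡ []      q r = ≈-refl
    distribˡ (a ∷ p) q r = begin
      a · (q + r) + (R.0# ∷ p * (q + r))
        ≈⟨ +-cong (·-distribˡ a q r) (0∷-cong (distribˡ p q r)) ⟩
      (a · q + a · r) + (R.0# ∷ p * q + p * r)
        ≈⟨ +-cong (≈-refl {a · q + a · r}) (0∷-+ (p * q) (p * r)) ⟩
      (a · q + a · r) + ((R.0# ∷ p * q) + (R.0# ∷ p * r))
        ≈⟨ interchange (a · q) (a · r) (R.0# ∷ p * q) (R.0# ∷ p * r) ⟩
      (a · q + (R.0# ∷ p * q)) + (a · r + (R.0# ∷ p * r)) ∎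

    distribʳ : ∀ p q r → (q + r) * p ≈ q * p + r * p
    distribʳ p q r = begin
      (q + r) * p   ≈⟨ *-comm (q + r) p ⟩
      p * (q + r)   ≈⟨ distribˡ p q r ⟩
      p * q + p * r ≈⟨ +-cong (*-comm p q) (*-comm p r) ⟩
      q * p + r * p ∎

    ·-* : ∀ a p q → (a · p) * q ≈ a · (p * q)
    ·-* a []      q = ≈-refl
    ·-* a (b ∷ p) q = begin
      (a R.* b) · q + (R.0# ∷ (a · p) * q)
        ≈⟨ +-cong (·-assoc a b q) (∷-cong (R.sym (R.zeroʳ a)) (·-* a p q)) ⟩
      a · (b · q) + a · (R.0# ∷ p * q)
        ≈⟨ ·-distribˡ a (b · q) (R.0# ∷ p * q) ⟨
      a · (b · q + (R.0# ∷ p * q)) ∎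

    *-assoc : ∀ p q r → (p * q) * r ≈ p * (q * r)
    *-assoc []      q r = ≈-refl
    *-assoc (a ∷ p) q r = begin
      (a · q + (R.0# ∷ p * q)) * r        ≈⟨ distribʳ r (a · q) (R.0# ∷ p * q) ⟩
      (a · q) * r + (R.0# ∷ p * q) * r    ≈⟨ +-cong (·-* a q r) (0∷-* (p * q) r) ⟩
      a · (q * r) + (R.0# ∷ (p * q) * r)  ≈⟨ +-cong (≈-refl {a · (q * r)}) (0∷-cong (*-assoc p q r)) ⟩
      a · (q * r) + (R.0# ∷ p * (q * r))  ∎

    *-identityˡ : ∀ p → 1# * p ≈ p
    *-identityˡ p = ≈-trans (+-cong (1· p) 0∷[]) (+-identityʳ p)

    *-identityʳ : ∀ p → p * 1# ≈ p
    *-identityʳ p = ≈-trans (*-comm p 1#) (*-identityˡ p)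

  commutativeRing : CommutativeRing c ℓ
  commutativeRing = record
    { Carrier = Poly ; _≈_ = _≈_ ; _+_ = _+_ ; _*_ = _*_ ; -_ = -_ ; 0# = 0# ; 1# = 1#
    ; isCommutativeRing = record
      { isRing = record
        { +-isAbelianGroup = record
          { isGroup = record
            { isMonoid = record
              { isSemigroup = record
                { isMagma = record { isEquivalence = ≈-isEquivalence ; ∙-cong = +-cong }
                ; assoc = +-assoc }
              ; identity = +-identityˡ , +-identityʳ }
            ; inverse = -‿inverseˡ , -‿inverseʳ
            ; ⁻¹-cong = -‿cong }
          ; comm = +-comm }
        ; *-cong = *-cong
        ; *-assoc = *-assoc
        ; *-identity = *-identityˡ , *-identityʳ
        ; distrib = distribˡ , distribʳ }
      ; *-comm = *-comm } }

  ≈0? : (∀ a → Dec (a R.≈ R.0#)) → ∀ p → Dec (p ≈ 0#)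
  ≈0? dec []      = yes ≈-refl
  ≈0? dec (a ∷ p) =
    map′ (λ (e , f) → ≈-trans (∷-cong e f) 0∷[])
         (λ e → e .coeff-≈ 0 , mk≈ (λ n → e .coeff-≈ (suc n)))
         (dec a ×-dec ≈0? dec p)

  1≉0 : ¬ (R.1# R.≈ R.0#) → ¬ (1# ≈ 0#)
  1≉0 ne e = ne (e .coeff-≈ 0)

  private
    0∷≈0 : ∀ {a p} → a R.≈ R.0# → p ≈ 0# → (a ∷ p) ≈ 0#
    0∷≈0 e f = ≈-trans (∷-cong e f) 0∷[]

    tail≈0 : ∀ {a p} → (a ∷ p) ≈ 0# → p ≈ 0#
    tail≈0 e .coeff-≈ n = e .coeff-≈ (suc n)

    drop-0ˡ : ∀ {a} p q → a R.≈ R.0# → (a ∷ p) * q ≈ 0# → p * q ≈ 0#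
    drop-0ˡ {a} p q a≈0 e = tail≈0 (begin
      R.0# ∷ p * q    ≈⟨ 0∷-* p q ⟨
      (R.0# ∷ p) * q  ≈⟨ *-cong (∷-cong a≈0 (≈-refl {p})) (≈-refl {q}) ⟨
      (a ∷ p) * q     ≈⟨ e ⟩
      0#              ∎)

    drop-0ʳ : ∀ {b} p q → b R.≈ R.0# → p * (b ∷ q) ≈ 0# → p * q ≈ 0#
    drop-0ʳ {b} p q b≈0 e =
      ≈-trans (*-comm p q) (drop-0ˡ q p b≈0 (≈-trans (*-comm (b ∷ q) p) e))

  noZeroDivisors : (∀ a b → a R.* b R.≈ R.0# → a R.≈ R.0# ⊎ b R.≈ R.0#) →
                   ∀ p q → p * q ≈ 0# → p ≈ 0# ⊎ q ≈ 0#
  noZeroDivisors nzd []      q       e = inj₁ ≈-refl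
  noZeroDivisors nzd (a ∷ p) []      e = inj₂ ≈-refl
  noZeroDivisors nzd (a ∷ p) (b ∷ q) e =
    [ (λ a≈0 → Sum.map₁ (0∷≈0 a≈0)
        (noZeroDivisors nzd p (b ∷ q) (drop-0ˡ p (b ∷ q) a≈0 e)))
    , (λ b≈0 → Sum.map₂ (0∷≈0 b≈0)
        (noZeroDivisors nzd (a ∷ p) q (drop-0ʳ (a ∷ p) q b≈0 e)))
    ]′ (nzd a b (R.trans (R.sym (R.+-identityʳ _)) (e .coeff-≈ 0)))

module Fractions {c ℓ} (R : CommutativeRing c ℓ)
  (≈0? : ∀ a → Dec (CommutativeRing._≈_ R a (CommutativeRing.0# R)))
  (1≉0 : ¬ (CommutativeRing._≈_ R (CommutativeRing.1# R) (CommutativeRing.0# R)))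
  (noZeroDivisors : ∀ a b →
    CommutativeRing._≈_ R (CommutativeRing._*_ R a b) (CommutativeRing.0# R) →
    CommutativeRing._≈_ R a (CommutativeRing.0# R) ⊎ CommutativeRing._≈_ R b (CommutativeRing.0# R))
  where

  private
    module R = CommutativeRing R
    D = R.Carrier
    open RingProperties R.ring using (-‿distribˡ-*; x∙y⁻¹≈ε⇒x≈y; -0#≈0#)
    open SemiringSolver R.commutativeSemiring using (solve; _:=_; _:+_; _:*_; con)
    open SetoidReasoning R.setoid

  infix 5 _/_[_]
  record Fraction : Set (c ⊔ ℓ) where
    constructor _/_[_]
    field
      num den : D
      den≉0   : ¬ (den R.≈ R.0#)
  open Fraction public

  infix 4 _≈_
  record _≈_ (x y : Fraction) : Set ℓ where
    constructor mk≈
    field cross : num x R.* den y R.≈ num y R.* den x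
  open _≈_ public

  private
    *-≉0 : ∀ {a b} → ¬ (a R.≈ R.0#) → ¬ (b R.≈ R.0#) → ¬ (a R.* b R.≈ R.0#)
    *-≉0 a≉0 b≉0 e = [ a≉0 , b≉0 ]′ (noZeroDivisors _ _ e)

    cancel : ∀ {a b d} → ¬ (d R.≈ R.0#) → a R.* d R.≈ b R.* d → a R.≈ b
    cancel {a} {b} {d} d≉0 e with noZeroDivisors (a R.- b) d (begin
      (a R.- b) R.* d           ≈⟨ R.distribʳ d a (R.- b) ⟩
      a R.* d R.+ R.- b R.* d   ≈⟨ R.+-cong e (R.sym (-‿distribˡ-* b d)) ⟩
      b R.* d R.- b R.* d       ≈⟨ R.-‿inverseʳ _ ⟩
      R.0#                      ∎)
    ... | inj₁ a-b≈0 = x∙y⁻¹≈ε⇒x≈y a b a-b≈0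
    ... | inj₂ d≈0   = contradiction d≈0 d≉0

  infix  8 -_
  infix  9 _⁻¹
  infixl 7 _*_
  infixl 6 _+_

  embed : D → Fraction
  embed a = a / R.1# [ 1≉0 ]

  0# 1# : Fraction
  0# = embed R.0#
  1# = embed R.1#

  _+_ _*_ : Fraction → Fraction → Fraction
  (a / b [ b≉0 ]) + (c / d [ d≉0 ]) = (a R.* d R.+ c R.* b) / (b R.* d) [ *-≉0 b≉0 d≉0 ]
  (a / b [ b≉0 ]) * (c / d [ d≉0 ]) = (a R.* c) / (b R.* d) [ *-≉0 b≉0 d≉0 ]

  -_ : Fraction → Fraction
  - (a / b [ b≉0 ]) = (R.- a) / b [ b≉0 ]

  -- 0# ⁻¹ is 0# by convention
  _⁻¹ : Fraction → Fraction
  (a / b [ b≉0 ]) ⁻¹ with ≈0? a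
  ... | yes _  = 0#
  ... | no a≉0 = b / a [ a≉0 ]

  private
    ≈-trans : ∀ {x y z} → x ≈ y → y ≈ z → x ≈ z
    ≈-trans {a / b [ _ ]} {c / d [ d≉0 ]} {e / f [ _ ]} (mk≈ p) (mk≈ q) = mk≈ (cancel d≉0 (begin
      a R.* f R.* d ≈⟨ solve 3 (λ a f d → a :* f :* d := a :* d :* f) R.refl a f d ⟩
      a R.* d R.* f ≈⟨ R.*-congʳ p ⟩
      c R.* b R.* f ≈⟨ solve 3 (λ c b f → c :* b :* f := c :* f :* b) R.refl c b f ⟩
      c R.* f R.* b ≈⟨ R.*-congʳ q ⟩
      e R.* d R.* b ≈⟨ solve 3 (λ e d b → e :* d :* b := e :* b :* d) R.refl e d b ⟩
      e R.* b R.* d ∎))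

  ≈-isEquivalence : IsEquivalence _≈_
  ≈-isEquivalence = record
    { refl  = mk≈ R.refl
    ; sym   = λ (mk≈ e) → mk≈ (R.sym e)
    ; trans = ≈-trans
    }

  private
    +-cong : ∀ {x x′ y y′} → x ≈ x′ → y ≈ y′ → x + y ≈ x′ + y′
    +-cong {a / b [ _ ]} {a′ / b′ [ _ ]} {c / d [ _ ]} {c′ / d′ [ _ ]} (mk≈ p) (mk≈ q) = mk≈ (begin
      (a R.* d R.+ c R.* b) R.* (b′ R.* d′)
        ≈⟨ solve 6 (λ a d c b b′ d′ → (a :* d :+ c :* b) :* (b′ :* d′)
             := (a :* b′) :* (d :* d′) :+ (c :* d′) :* (b :* b′)) R.refl a d c b b′ d′ ⟩
      (a R.* b′) R.* (d R.* d′) R.+ (c R.* d′) R.* (b R.* b′)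
        ≈⟨ R.+-cong (R.*-congʳ p) (R.*-congʳ q) ⟩
      (a′ R.* b) R.* (d R.* d′) R.+ (c′ R.* d) R.* (b R.* b′)
        ≈⟨ solve 6 (λ a′ d c′ b b′ d′ → (a′ :* b) :* (d :* d′) :+ (c′ :* d) :* (b :* b′)
             := (a′ :* d′ :+ c′ :* b′) :* (b :* d)) R.refl a′ d c′ b b′ d′ ⟩
      (a′ R.* d′ R.+ c′ R.* b′) R.* (b R.* d) ∎)

    *-cong : ∀ {x x′ y y′} → x ≈ x′ → y ≈ y′ → x * y ≈ x′ * y′
    *-cong {a / b [ _ ]} {a′ / b′ [ _ ]} {c / d [ _ ]} {c′ / d′ [ _ ]} (mk≈ p) (mk≈ q) = mk≈ (begin
      (a R.* c) R.* (b′ R.* d′)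
        ≈⟨ solve 4 (λ a c b′ d′ → (a :* c) :* (b′ :* d′) := (a :* b′) :* (c :* d′)) R.refl a c b′ d′ ⟩
      (a R.* b′) R.* (c R.* d′) ≈⟨ R.*-cong p q ⟩
      (a′ R.* b) R.* (c′ R.* d)
        ≈⟨ solve 4 (λ a′ b c′ d → (a′ :* b) :* (c′ :* d) := (a′ :* c′) :* (b :* d)) R.refl a′ b c′ d ⟩
      (a′ R.* c′) R.* (b R.* d) ∎)

    -‿cong : ∀ {x y} → x ≈ y → - x ≈ - y
    -‿cong {a / b [ _ ]} {c / d [ _ ]} (mk≈ p) = mk≈ (begin
      R.- a R.* d   ≈⟨ -‿distribˡ-* a d ⟨
      R.- (a R.* d) ≈⟨ R.-‿cong p ⟩
      R.- (c R.* b) ≈⟨ -‿distribˡ-* c b ⟩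
      R.- c R.* b   ∎)

    +-comm : ∀ x y → x + y ≈ y + x
    +-comm (a / b [ _ ]) (c / d [ _ ]) = mk≈
      (solve 4 (λ a b c d → (a :* d :+ c :* b) :* (d :* b) := (c :* b :+ a :* d) :* (b :* d))
        R.refl a b c d)

    +-assoc : ∀ x y z → (x + y) + z ≈ x + (y + z)
    +-assoc (a / b [ _ ]) (c / d [ _ ]) (e / f [ _ ]) = mk≈
      (solve 6 (λ a b c d e f →
          ((a :* d :+ c :* b) :* f :+ e :* (b :* d)) :* (b :* (d :* f))
          := (a :* (d :* f) :+ (c :* f :+ e :* d) :* b) :* ((b :* d) :* f))
        R.refl a b c d e f)

    +-identityˡ : ∀ x → 0# + x ≈ x
    +-identityˡ (a / b [ _ ]) = mk≈
      (solve 2 (λ a b → (con 0 :* b :+ a :* con 1) :* b := a :* (con 1 :* b)) R.refl a b)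

    -‿inverseˡ : ∀ x → - x + x ≈ 0#
    -‿inverseˡ (a / b [ _ ]) = mk≈ (begin
      (R.- a R.* b R.+ a R.* b) R.* R.1# ≈⟨ R.*-identityʳ _ ⟩
      R.- a R.* b R.+ a R.* b            ≈⟨ R.distribʳ b (R.- a) a ⟨
      (R.- a R.+ a) R.* b                ≈⟨ R.*-congʳ (R.-‿inverseˡ a) ⟩
      R.0# R.* b                         ≈⟨ R.zeroˡ b ⟩
      R.0#                               ≈⟨ R.zeroˡ _ ⟨
      R.0# R.* (b R.* b)                 ∎)

    *-comm : ∀ x y → x * y ≈ y * x
    *-comm (a / b [ _ ]) (c / d [ _ ]) = mk≈ (R.*-cong (R.*-comm a c) (R.*-comm d b))

    *-assoc : ∀ x y z → (x * y) * z ≈ x * (y * z)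
    *-assoc (a / b [ _ ]) (c / d [ _ ]) (e / f [ _ ]) =
      mk≈ (R.*-cong (R.*-assoc a c e) (R.sym (R.*-assoc b d f)))

    *-identityˡ : ∀ x → 1# * x ≈ x
    *-identityˡ (a / b [ _ ]) = mk≈
      (R.trans (R.*-congʳ (R.*-identityˡ a)) (R.*-congˡ (R.sym (R.*-identityˡ b))))

    distribˡ : ∀ x y z → x * (y + z) ≈ x * y + x * z
    distribˡ (a / b [ _ ]) (c / d [ _ ]) (e / f [ _ ]) = mk≈
      (solve 6 (λ a b c d e f →
          (a :* (c :* f :+ e :* d)) :* ((b :* d) :* (b :* f))
          := ((a :* c) :* (b :* f) :+ (a :* e) :* (b :* d)) :* (b :* (d :* f)))
        R.refl a b c d e f)

    +-identityʳ : ∀ x → x + 0# ≈ x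
    +-identityʳ x = ≈-trans (+-comm x 0#) (+-identityˡ x)

    -‿inverseʳ : ∀ x → x + - x ≈ 0#
    -‿inverseʳ x = ≈-trans (+-comm x (- x)) (-‿inverseˡ x)

    *-identityʳ : ∀ x → x * 1# ≈ x
    *-identityʳ x = ≈-trans (*-comm x 1#) (*-identityˡ x)

    distribʳ : ∀ x y z → (y + z) * x ≈ y * x + z * x
    distribʳ x y z = ≈-trans (*-comm (y + z) x)
      (≈-trans (distribˡ x y z) (+-cong (*-comm x y) (*-comm x z)))

  commutativeRing : CommutativeRing (c ⊔ ℓ) ℓ
  commutativeRing = record
    { Carrier = Fraction ; _≈_ = _≈_ ; _+_ = _+_ ; _*_ = _*_ ; -_ = -_ ; 0# = 0# ; 1# = 1#
    ; isCommutativeRing = record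
      { isRing = record
        { +-isAbelianGroup = record
          { isGroup = record
            { isMonoid = record
              { isSemigroup = record
                { isMagma = record { isEquivalence = ≈-isEquivalence ; ∙-cong = +-cong }
                ; assoc = +-assoc }
              ; identity = +-identityˡ , +-identityʳ }
            ; inverse = -‿inverseˡ , -‿inverseʳ
            ; ⁻¹-cong = -‿cong }
          ; comm = +-comm }
        ; *-cong = *-cong
        ; *-assoc = *-assoc
        ; *-identity = *-identityˡ , *-identityʳ
        ; distrib = distribˡ , distribʳ }
      ; *-comm = *-comm } }

  *-inverseʳ : ∀ x → ¬ (x ≈ 0#) → x * x ⁻¹ ≈ 1#
  *-inverseʳ (a / b [ _ ]) x≉0 with ≈0? a
  ... | yes a≈0 = contradiction (mk≈ (R.trans (R.*-identityʳ a) (R.trans a≈0 (R.sym (R.zeroˡ b))))) x≉0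
  ... | no  a≉0 = mk≈ (solve 2 (λ a b → (a :* b) :* con 1 := con 1 :* (b :* a)) R.refl a b)

ℚ-noZeroDivisors : ∀ p q → p ℚ.* q ≡ ℚ.0ℚ → p ≡ ℚ.0ℚ ⊎ q ≡ ℚ.0ℚ
ℚ-noZeroDivisors p q pq≡0 with p ℚ.≟ ℚ.0ℚ
... | yes p≡0 = inj₁ p≡0
... | no  p≢0 = inj₂ (begin
  q                     ≡⟨ ℚ.*-identityˡ q ⟨
  ℚ.1ℚ ℚ.* q            ≡⟨ cong (ℚ._* q) (ℚ.*-inverseˡ p) ⟨
  (ℚ.1/ p ℚ.* p) ℚ.* q  ≡⟨ ℚ.*-assoc (ℚ.1/ p) p q ⟩
  ℚ.1/ p ℚ.* (p ℚ.* q)  ≡⟨ cong (ℚ.1/ p ℚ.*_) pq≡0 ⟩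
  ℚ.1/ p ℚ.* ℚ.0ℚ       ≡⟨ ℚ.*-zeroʳ (ℚ.1/ p) ⟩
  ℚ.0ℚ                  ∎)
  where
  open Relation.Binary.PropositionalEquality.≡-Reasoning
  instance _ = ℚ.≢-nonZero p≢0

ℚ-1≢0 : ℚ.1ℚ ≢ ℚ.0ℚ
ℚ-1≢0 ()

module ℚ[x] = Polynomials ℚ.+-*-commutativeRing

module ℚ⟨x⟩ = Fractions ℚ[x].commutativeRing
  (ℚ[x].≈0? (ℚ._≟ ℚ.0ℚ)) (ℚ[x].1≉0 ℚ-1≢0) (ℚ[x].noZeroDivisors ℚ-noZeroDivisors)

ℚ⟨x⟩-commutativeRing : CommutativeRing 0ℓ 0ℓ
ℚ⟨x⟩-commutativeRing = ℚ⟨x⟩.commutativeRing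

𝐱 : ℚ⟨x⟩.Fraction
𝐱 = ℚ⟨x⟩.embed ℚ[x].X

record Graph (n : ℕ) : Set₁ where
  infix 4 _~_ _~?_
  field
    _~_    : Rel (Fin n) 0ℓ
    _~?_   : Decidable _~_
    ~-sym  : Symmetric _~_
    ~-irr  : Irreflexive _≡_ _~_

module _ {n} (X : Graph n) where
  open Graph X

  neighbours : Fin n → Subset n
  neighbours v = tabulate (λ w → does (v ~? w))

  degree : Fin n → ℕ
  degree v = ∣ neighbours v ∣

  Regular : ℕ → Set
  Regular r = ∀ v → degree v ≡ r

  -- An edge together with an (arbitrary) choice of its first end.
  record Edge : Set where
    field
      source target : Fin n
      adjacent      : source ~ target

module _ {n} {X : Graph n} where
  open Graph X
  open Edge

  ends-distinct : (e : Edge X) → source e ≢ target e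
  ends-distinct e eq = ~-irr eq (adjacent e)

  Joins : Edge X → Rel (Fin n) 0ℓ
  Joins e v w = (source e ≡ v × target e ≡ w) ⊎ (source e ≡ w × target e ≡ v)

  -- No two of the edges e₁, …, e_k are equal as unordered pairs.
  Distinct : ∀ {k} → (Fin k → Edge X) → Set
  Distinct E = ∀ {i j v w} → Joins (E i) v w → Joins (E j) v w → i ≡ j

  _EndOf_ : Fin n → Edge X → Set
  v EndOf e = source e ≡ v ⊎ target e ≡ v

  spanningSubgraph : ∀ {k} → (Fin k → Edge X) → Graph n
  spanningSubgraph E = record
    { _~_   = λ v w → ∃ λ i → Joins (E i) v w
    ; _~?_  = λ v w → any? λ i →
        ((source (E i) ≟ v) ×-dec (target (E i) ≟ w)) ⊎-dec
        ((source (E i) ≟ w) ×-dec (target (E i) ≟ v))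
    ; ~-sym = λ (i , J) → i , Sum.swap J
    ; ~-irr = λ { refl (i , inj₁ (s , t)) → ends-distinct (E i) (trans s (sym t))
                ; refl (i , inj₂ (s , t)) → ends-distinct (E i) (trans s (sym t)) }
    }

-- The subgraph induced by the vertices f 0, f 1, …, labelled by Fin m
-- (f is injective in every use below).
induced : ∀ {m n} → (Fin m → Fin n) → Graph n → Graph m
induced f X = record
  { _~_   = _~_ on f
  ; _~?_  = λ i j → f i ~? f j
  ; ~-sym = ~-sym
  ; ~-irr = λ eq → ~-irr (cong f eq)
  }
  where open Graph X

-- The order-preserving enumeration of the vertices other than u and v.
others : ∀ {h} {u v : Fin (2 ℕ.+ h)} → u ≢ v → Fin h → Fin (2 ℕ.+ h)
others {u = u} u≢v j = punchIn u (punchIn (punchOut u≢v) j)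

deleteEnds : ∀ {h} (H : Graph (2 ℕ.+ h)) → Edge H → Graph h
deleteEnds H uv = induced (others (ends-distinct uv)) H

-- The subgraph whose edges are those of E and whose vertices are the ends of
-- these edges, in case these ends are exactly the first p vertices.
module _ {p q : ℕ} {F : Graph (p ℕ.+ q)} {k} (E : Fin k → Edge F) where

  EndsComeFirst : Set
  EndsComeFirst = ∀ v → (∃ λ i → v EndOf E i) ⇔ (∃ λ (j : Fin p) → v ≡ j ↑ˡ q)

  edgeInduced : Graph p
  edgeInduced = induced (_↑ˡ q) (spanningSubgraph E)

-- Graphs with edge-pockets.  The vertices of G[F,E,H] are those of F followed,
-- for each i, by the vertices of H other than u and v.  The map `paste i` sends
-- the i-th copy of H to G, identifying u and v with the ends of the i-th edge;
-- the edges of G are the images of the edges of F and of the copies of H.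

module EdgePockets {n h k} (F : Graph n) (E : Fin k → Edge F)
                   (H : Graph (2 ℕ.+ h)) (uv : Edge H) where

  private
    module F = Graph F
    module H = Graph H
    open Edge uv renaming (source to u; target to v)
    open Edge using (source; target)

    u≢v : u ≢ v
    u≢v = ends-distinct uv

  order : ℕ
  order = n ℕ.+ k ℕ.* h

  base : Fin n → Fin order
  base = _↑ˡ (k ℕ.* h)

  new : Fin k → Fin h → Fin order
  new i j = n ↑ʳ combine i j

  private
    apart : ∀ {w} (u≢w : u ≢ w) → v ≢ w → punchOut u≢v ≢ punchOut u≢w
    apart u≢w v≢w eq = v≢w (punchOut-injective u≢v u≢w eq)

  -- The position of w in the enumeration `others`.
  rank : ∀ {w} → u ≢ w → v ≢ w → Fin h
  rank u≢w v≢w = punchOut (apart u≢w v≢w)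

  paste : Fin k → Fin (2 ℕ.+ h) → Fin order
  paste i w with u ≟ w | v ≟ w
  ... | yes _  | _      = base (source (E i))
  ... | no _   | yes _  = base (target (E i))
  ... | no u≢w | no v≢w = new i (rank u≢w v≢w)

  private
    base≢new : ∀ {a i j} → base a ≢ new i j
    base≢new {a} {i} {j} eq
      with () ← trans (sym (splitAt-↑ˡ n a (k ℕ.* h)))
                      (trans (cong (splitAt n) eq) (splitAt-↑ʳ n (k ℕ.* h) (combine i j)))

    base-injective : Injective _≡_ _≡_ base
    base-injective {a} {b} = ↑ˡ-injective (k ℕ.* h) a b

    rank-injective : ∀ {w z} (a : u ≢ w) (b : v ≢ w) (c : u ≢ z) (d : v ≢ z) →
                     rank a b ≡ rank c d → w ≡ z
    rank-injective a b c d eq = punchOut-injective a c (punchOut-injective (apart a b) (apart c d) eq)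

    new-injective : ∀ {i j l} → new i j ≡ new i l → j ≡ l
    new-injective {i} {j} {l} eq = combine-injectiveʳ i j i l (↑ʳ-injective n _ _ eq)

  paste-injective : ∀ i → Injective _≡_ _≡_ (paste i)
  paste-injective i {w} {z} eq with u ≟ w | v ≟ w | u ≟ z | v ≟ z
  ... | yes a | _     | yes c | _     = trans (sym a) c
  ... | yes _ | _     | no _  | yes _ = contradiction (base-injective eq) (ends-distinct (E i))
  ... | yes _ | _     | no _  | no _  = contradiction eq base≢new
  ... | no _  | yes _ | yes _ | _     = contradiction (sym (base-injective eq)) (ends-distinct (E i))
  ... | no _  | yes b | no _  | yes d = trans (sym b) d
  ... | no _  | yes _ | no _  | no _  = contradiction eq base≢new
  ... | no _  | no _  | yes _ | _     = contradiction (sym eq) base≢new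
  ... | no _  | no _  | no _  | yes _ = contradiction (sym eq) base≢new
  ... | no a  | no b  | no c  | no d  = rank-injective a b c d (new-injective eq)

  data _~_ : Rel (Fin order) 0ℓ where
    baseEdge   : ∀ {a b} → a F.~ b → base a ~ base b
    pocketEdge : ∀ i {w z} → w H.~ z → paste i w ~ paste i z

  private
    Presented : Rel (Fin order) 0ℓ
    Presented x y =
        (∃₂ λ a b → a F.~ b × base a ≡ x × base b ≡ y)
      ⊎ (∃ λ i → ∃₂ λ w z → w H.~ z × paste i w ≡ x × paste i z ≡ y)

    present : ∀ {x y} → x ~ y → Presented x y
    present (baseEdge e)     = inj₁ (_ , _ , e , refl , refl)
    present (pocketEdge i e) = inj₂ (i , _ , _ , e , refl , refl)

    unpresent : ∀ {x y} → Presented x y → x ~ y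
    unpresent (inj₁ (_ , _ , e , refl , refl))     = baseEdge e
    unpresent (inj₂ (i , _ , _ , e , refl , refl)) = pocketEdge i e

    presented? : Decidable Presented
    presented? x y =
      (any? λ a → any? λ b → (a F.~? b) ×-dec (base a ≟ x) ×-dec (base b ≟ y))
      ⊎-dec
      (any? λ i → any? λ w → any? λ z → (w H.~? z) ×-dec (paste i w ≟ x) ×-dec (paste i z ≟ y))

    presented-irr : ∀ {x} → ¬ Presented x x
    presented-irr (inj₁ (_ , _ , e , p , q))     = F.~-irr (base-injective (trans p (sym q))) e
    presented-irr (inj₂ (i , _ , _ , e , p , q)) = H.~-irr (paste-injective i (trans p (sym q))) e

  edgePocketGraph : Graph order
  edgePocketGraph = record
    { _~_   = _~_
    ; _~?_  = λ x y → map′ unpresent present (presented? x y)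
    ; ~-sym = λ { (baseEdge e) → baseEdge (F.~-sym e) ; (pocketEdge i e) → pocketEdge i (H.~-sym e) }
    ; ~-irr = λ { refl e → presented-irr (present e) }
    }

open EdgePockets public using (edgePocketGraph)

module Matrices {c ℓ} (R : CommutativeRing c ℓ) where

  open CommutativeRing R using (Carrier; _+_; _*_; -_; 0#; 1#; semiring)
  open RawSemiringDefs (Semiring.rawSemiring semiring) using (sum; _^_) renaming (_×_ to _×ᴿ_)

  Matrix : ℕ → ℕ → Set c
  Matrix m n = Fin m → Fin n → Carrier

  fromℕ : ℕ → Carrier
  fromℕ n = n ×ᴿ 1#

  infixl 6 _⊞_ _⊟_
  infixr 7 _⊡_

  _⊞_ _⊟_ : ∀ {m n} → Matrix m n → Matrix m n → Matrix m n
  (A ⊞ B) i j = A i j + B i j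
  (A ⊟ B) i j = A i j + - B i j

  _⊡_ : ∀ {m n} → Carrier → Matrix m n → Matrix m n
  (a ⊡ A) i j = a * A i j

  diagonal : ∀ {n} → (Fin n → Carrier) → Matrix n n
  diagonal d i j with i ≟ j
  ... | yes _ = d i
  ... | no  _ = 0#

  𝟙 : ∀ {n} → Matrix n n
  𝟙 = diagonal (const 1#)

  -- The block matrix with A in the upper left corner and zeros elsewhere.
  corner : ∀ {p} q → Matrix p p → Matrix (p ℕ.+ q) (p ℕ.+ q)
  corner {p} q A i j =
    [ (λ i′ → [ A i′ , const 0# ]′ (splitAt p j)) , const 0# ]′ (splitAt p i)

  minor : ∀ {n} → Fin (suc n) → Fin (suc n) → Matrix (suc n) (suc n) → Matrix n n
  minor i j A r s = A (punchIn i r) (punchIn j s)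

  sign : ℕ → Carrier
  sign k = (- 1#) ^ k

  -- Expansion along the first row.
  det : ∀ {n} → Matrix n n → Carrier
  det {zero}  A = 1#
  det {suc n} A = sum (λ j → sign (toℕ j) * (A zero j * det (minor zero j A)))

  adjugate : ∀ {n} → Matrix n n → Matrix n n
  adjugate {suc n} A i j = sign (toℕ i ℕ.+ toℕ j) * det (minor j i A)

  charPoly : ∀ {n} → Matrix n n → Carrier → Carrier
  charPoly N t = det (t ⊡ 𝟙 ⊟ N)

  adjacencyMatrix : ∀ {n} → Graph n → Matrix n n
  adjacencyMatrix X i j with Graph._~?_ X i j
  ... | yes _ = 1#
  ... | no  _ = 0#

  degreeMatrix : ∀ {n} → Graph n → Matrix n n
  degreeMatrix X = diagonal (fromℕ ∘ degree X)

  signlessLaplacian : ∀ {n} → Graph n → Matrix n n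
  signlessLaplacian X = degreeMatrix X ⊞ adjacencyMatrix X

open CommutativeRing ℚ⟨x⟩-commutativeRing public using (_≈_; _*_; _-_; semiring)
open RawSemiringDefs (Semiring.rawSemiring semiring) public using (sum; _^_)
open Matrices ℚ⟨x⟩-commutativeRing public

-- A⁻¹ = (det A)⁻¹ adj A, meaningful when det A ≉ 0#.
inverse : ∀ {n} → Matrix n n → Matrix n n
inverse A = det A ℚ⟨x⟩.⁻¹ ⊡ adjugate A

-- Γ_N(t) = 𝟏ᵀ (t I − N)⁻¹ 𝟏.  When the entries of N are constants and t = x − a
-- with a constant, det (t I − N) is a monic polynomial in x up to the embedding of
-- ℚ[x] in ℚ(x), so that the inverse exists.
coronal : ∀ {n} → Matrix n n → ℚ⟨x⟩.Fraction → ℚ⟨x⟩.Fraction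
coronal N t = sum (λ i → sum (λ j → inverse (t ⊡ 𝟙 ⊟ N) i j))

-- Order the vertices of G as those of F followed by the pockets. With y = x − 2, the
-- matrix xI − Q(G) then has lower right block I_k ⊗ (yI − Q(H₂)), and its off-diagonal
-- blocks are −B ⊗ 𝟏ᵀ and its transpose, B being the vertex-edge incidence matrix of E.
-- Since 𝟏ᵀ (yI − Q(H₂))⁻¹ 𝟏 = Γ(y), the Schur complement of the lower right block is
-- xI − Q(F) − r(m−2) I_p − Γ(y) B Bᵀ, and B Bᵀ = Q(𝓔).  The block is invertible over
-- ℚ(x) because the characteristic polynomial of Q(H₂) is monic.

module Submission where

open import Algebra.Bundles using (CommutativeRing; Semiring)
import Algebra.Definitions.RawSemiring as RawSemiringDefs
import Algebra.Properties.AbelianGroup as AbelianGroupProperties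
import Algebra.Properties.CommutativeSemigroup as CommutativeSemigroupProperties
import Algebra.Properties.Ring as RingProperties
import Algebra.Properties.Semiring.Mult as SemiringMult
import Algebra.Properties.Semiring.Sum as SemiringSum
open import Data.Bool.Base using (Bool; true; false; if_then_else_)
open import Data.Fin.Base
  using (Fin; zero; suc; toℕ; _↑ˡ_; _↑ʳ_; splitAt; combine; quotient; remainder; punchIn; punchOut)
open import Data.Fin.Properties
  using (_≟_; any?; toℕ-↑ˡ; ↑ˡ-injective; ↑ʳ-injective; splitAt-↑ˡ; splitAt-↑ʳ; splitAt⁻¹-↑ˡ; splitAt⁻¹-↑ʳ
        ; combine-injective; combine-surjective; remQuot-combine
        ; punchInᵢ≢i; punchIn-injective; punchIn-punchOut; punchOut-punchIn; punchOut-cong)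
open import Data.Fin.Subset using (_∈_; ∁; ⁅_⁆; ∣_∣; _⊂_)
open import Data.Fin.Subset.Properties using (x∉p⇒x∈∁p; x∈⁅y⁆⇒x≡y; p⊂q⇒∣p∣<∣q∣; ∣∁p∣≡n∸∣p∣; ∣⁅x⁆∣≡1)
import Data.List.Base as List
open import Data.Nat.Base as ℕ using (ℕ; zero; suc; _<_; _≤_; s≤s; z≤n)
import Data.Nat.Properties as ℕ
open import Data.Product.Base as Product using (∃; ∃₂; _×_; _,_; proj₁; proj₂; uncurry)
import Data.Rational.Base as ℚ
import Data.Rational.Properties as ℚ
open import Data.Sum.Base as Sum using (_⊎_; inj₁; inj₂; [_,_]′)
open import Data.Vec.Base using (tabulate)
import Data.Vec.Functional as Vector
open import Data.Vec.Properties using (lookup∘tabulate; []=⇒lookup)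
open import Defs
  using (Graph; Edge; neighbours; degree; Regular; ends-distinct; Joins; Distinct; _EndOf_; spanningSubgraph
        ; others; deleteEnds; EndsComeFirst; edgeInduced; module EdgePockets; edgePocketGraph
        ; module Polynomials; module Fractions; module Matrices)
open import Function.Base using (_∘_; const)
open import Function.Bundles using (_⇔_; mk⇔; Equivalence)
open import Level using (_⊔_)
open import Relation.Binary.PropositionalEquality as ≡ using (_≡_; _≢_)
import Relation.Binary.Reasoning.Setoid as SetoidReasoning
open import Relation.Nullary.Decidable using (Dec; yes; no; does; dec-false; does-⇔; _×-dec_; _⊎-dec_)
open import Relation.Nullary.Negation using (¬_; contradiction)

-- The lower right block has order k(m-2), and inverting it would mean building its inverse and
-- verifying it. This is avoided: clearing the upper right block takes only a matrix W whose product
-- with the lower right block is the upper right block. With N = yI - Q(H₂), each row of the upper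
-- right block is constant on every pocket, so W consists of multiples of 𝟏ᵀ N⁻¹; hence only the
-- coronal of H₂ survives. The adjugate identity gives N adj(N) = det(N) I, whereas W multiplies N
-- from the left; the symmetry of N closes this gap.
--
-- The computation is valid over every commutative ring with an element δ such that det(N) δ = 1.
-- There 2 may be a zero divisor, so the vanishing of a determinant with two equal rows does not
-- follow from the change of sign under a swap and is proved on its own. The fraction field enters
-- only to supply δ; as ℚ(x) carries no coefficients, det(N) is traced back to a polynomial together
-- with its top coefficient.
--
-- The 2 in x - 2 counts the ends of an edge, both adjacent to every vertex of its pocket; r(m-2)
-- counts the m-2 new neighbours from each of the r pockets at a vertex of 𝓔.

-- Determinants

-- Makes the minor left by deleting two columns independent of the order of deletion, as the
-- antisymmetry of `pairCofactor` requires.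
punchIn-swap : ∀ {n} {j k : Fin (2 ℕ.+ n)} (j≢k : j ≢ k) (k≢j : k ≢ j) (c : Fin n) →
               punchIn j (punchIn (punchOut j≢k) c) ≡ punchIn k (punchIn (punchOut k≢j) c)
punchIn-swap {_}     {zero}  {zero}  j≢k k≢j c = contradiction ≡.refl j≢k
punchIn-swap {_}     {zero}  {suc k} j≢k k≢j c = ≡.refl
punchIn-swap {_}     {suc j} {zero}  j≢k k≢j c = ≡.refl
punchIn-swap {suc n} {suc j} {suc k} j≢k k≢j zero    = ≡.refl
punchIn-swap {suc n} {suc j} {suc k} j≢k k≢j (suc c) =
  ≡.cong suc (punchIn-swap (j≢k ∘ ≡.cong suc) (k≢j ∘ ≡.cong suc) c)

punchIn-↑ʳ : ∀ {n m} (j : Fin (suc n)) (l : Fin m) → punchIn (j ↑ˡ m) (n ↑ʳ l) ≡ suc n ↑ʳ l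
punchIn-↑ʳ {n}     zero    l = ≡.refl
punchIn-↑ʳ {suc n} (suc j) l = ≡.cong suc (punchIn-↑ʳ j l)

punchIn-↑ˡ : ∀ {n m} (j : Fin (suc n)) (l : Fin n) → punchIn (j ↑ˡ m) (l ↑ˡ m) ≡ punchIn j l ↑ˡ m
punchIn-↑ˡ zero    l       = ≡.refl
punchIn-↑ˡ (suc j) zero    = ≡.refl
punchIn-↑ˡ (suc j) (suc l) = ≡.cong suc (punchIn-↑ˡ j l)

module Determinants {c ℓ} (R : CommutativeRing c ℓ) where

  open CommutativeRing R hiding (zero)
  open Vector using (_∷_)
  open Matrices R
  open RawSemiringDefs (Semiring.rawSemiring semiring) using (_^_)
  open RingProperties ring using (-1*x≈-x; -‿distribˡ-*; -‿distribʳ-*; -0#≈0#; -‿involutive)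
  open SemiringSum semiring
  open CommutativeSemigroupProperties *-commutativeSemigroup using (x∙yz≈y∙xz)
  open SetoidReasoning setoid

  sum-zero : ∀ {n} {f : Fin n → Carrier} → (∀ i → f i ≈ 0#) → sum f ≈ 0#
  sum-zero {n} f≈0 = trans (sum-cong-≋ f≈0) (sum-replicate-zero n)

  sum-++ : ∀ m {n} (f : Fin (m ℕ.+ n) → Carrier) →
           sum f ≈ sum (λ i → f (i ↑ˡ n)) + sum (λ j → f (m ↑ʳ j))
  sum-++ zero    f = sym (+-identityˡ _)
  sum-++ (suc m) f = trans (+-congˡ (sum-++ m (f ∘ suc))) (sym (+-assoc _ _ _))

  sum-combine : ∀ m {n} (f : Fin (m ℕ.* n) → Carrier) →
                sum f ≈ sum (λ i → sum (λ j → f (combine {m} {n} i j)))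
  sum-combine zero        f = refl
  sum-combine (suc m) {n} f =
    trans (sum-++ n f) (+-congˡ (sum-combine m (λ i → f (n ↑ʳ i))))

  sum-negate : ∀ {n} (f : Fin n → Carrier) → sum (λ i → - f i) ≈ - sum f
  sum-negate f = begin
    sum (λ i → - f i)        ≈⟨ sum-cong-≋ (λ i → -1*x≈-x (f i)) ⟨
    sum (λ i → - 1# * f i)   ≈⟨ *-distribˡ-sum (- 1#) f ⟨
    - 1# * sum f             ≈⟨ -1*x≈-x (sum f) ⟩
    - sum f                  ∎

  -- The terms at (j, k) and (k, j) cancel; the induction splits off the first row together with the
  -- first column. The diagonal needs its own hypothesis because `f j j + f j j ≈ 0#` does not force
  -- `f j j ≈ 0#` in a general ring.
  sum-alternating : ∀ {n} (f : Fin n → Fin n → Carrier) → (∀ j → f j j ≈ 0#) →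
                    (∀ j k → f j k + f k j ≈ 0#) → sum (λ j → sum (f j)) ≈ 0#
  sum-alternating {zero}  f diag anti = refl
  sum-alternating {suc n} f diag anti = begin
    (f zero zero + row) + sum (λ j → f (suc j) zero + sum (λ k → f (suc j) (suc k)))
      ≈⟨ +-cong (trans (+-congʳ (diag zero)) (+-identityˡ row))
                (∑-distrib-+ (λ j → f (suc j) zero) (λ j → sum (λ k → f (suc j) (suc k)))) ⟩
    row + (column + sum (λ j → sum (λ k → f (suc j) (suc k))))
      ≈⟨ +-congˡ (+-congˡ (sum-alternating (λ j k → f (suc j) (suc k)) (diag ∘ suc)
                            (λ j k → anti (suc j) (suc k)))) ⟩
    row + (column + 0#)  ≈⟨ +-congˡ (+-identityʳ column) ⟩
    row + column         ≈⟨ ∑-distrib-+ (λ j → f zero (suc j)) (λ j → f (suc j) zero) ⟨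
    sum (λ j → f zero (suc j) + f (suc j) zero)
                         ≈⟨ sum-zero (λ j → anti zero (suc j)) ⟩
    0#                   ∎
    where
    row    = sum (λ k → f zero (suc k))
    column = sum (λ j → f (suc j) zero)

  det-cong : ∀ {n} {A B : Matrix n n} → (∀ i j → A i j ≈ B i j) → det A ≈ det B
  det-cong {zero}  A≈B = refl
  det-cong {suc n} A≈B = sum-cong-≋ λ j → *-congˡ {sign (toℕ j)}
    (*-cong (A≈B zero j) (det-cong (λ r s → A≈B (suc r) (punchIn j s))))

  sign-suc : ∀ n → sign (suc n) ≈ - sign n
  sign-suc n = -1*x≈-x (sign n)

  sign-+ : ∀ m n → sign (m ℕ.+ n) ≈ sign m * sign n
  sign-+ zero    n = sym (*-identityˡ _)
  sign-+ (suc m) n = trans (*-congˡ (sign-+ m n)) (sym (*-assoc _ _ _))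

  -x*-y≈x*y : ∀ x y → - x * - y ≈ x * y
  -x*-y≈x*y x y = begin
    - x * - y    ≈⟨ -‿distribˡ-* x (- y) ⟨
    - (x * - y)  ≈⟨ -‿cong (-‿distribʳ-* x y) ⟨
    - - (x * y)  ≈⟨ -‿involutive (x * y) ⟩
    x * y        ∎

  sign² : ∀ n → sign n * sign n ≈ 1#
  sign² zero    = *-identityˡ 1#
  sign² (suc n) = begin
    sign (suc n) * sign (suc n)  ≈⟨ *-cong (sign-suc n) (sign-suc n) ⟩
    - sign n * - sign n          ≈⟨ -x*-y≈x*y (sign n) (sign n) ⟩
    sign n * sign n              ≈⟨ sign² n ⟩
    1#                           ∎

  -- Deleting one of two indices lowers the other by one exactly when the other is the larger. The
  -- two exponents are therefore j + k and j + k - 1 in some order.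
  sign-punchOut : ∀ {n} {j k : Fin (suc n)} (j≢k : j ≢ k) (k≢j : k ≢ j) →
                  sign (toℕ j) * sign (toℕ (punchOut j≢k)) ≈
                  - (sign (toℕ k) * sign (toℕ (punchOut k≢j)))
  sign-punchOut {_}     {zero}  {zero}  j≢k k≢j = contradiction ≡.refl j≢k
  sign-punchOut {suc n} {zero}  {suc k} j≢k k≢j = begin
    1# * sign (toℕ k)          ≈⟨ *-identityˡ _ ⟩
    sign (toℕ k)               ≈⟨ -‿involutive _ ⟨
    - - sign (toℕ k)           ≈⟨ -‿cong (trans (*-identityʳ _) (sign-suc (toℕ k))) ⟨
    - (sign (suc (toℕ k)) * 1#) ∎
  sign-punchOut {suc n} {suc j} {zero}  j≢k k≢j = begin
    sign (suc (toℕ j)) * 1#    ≈⟨ *-identityʳ _ ⟩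
    sign (suc (toℕ j))         ≈⟨ sign-suc (toℕ j) ⟩
    - sign (toℕ j)             ≈⟨ -‿cong (*-identityˡ _) ⟨
    - (1# * sign (toℕ j))      ∎
  sign-punchOut {suc n} {suc j} {suc k} j≢k k≢j = begin
    sign (suc (toℕ j)) * sign (suc (toℕ (punchOut j≢k′)))      ≈⟨ drop (toℕ j) (toℕ (punchOut j≢k′)) ⟩
    sign (toℕ j) * sign (toℕ (punchOut j≢k′))                  ≈⟨ sign-punchOut j≢k′ k≢j′ ⟩
    - (sign (toℕ k) * sign (toℕ (punchOut k≢j′)))              ≈⟨ -‿cong (drop (toℕ k) (toℕ (punchOut k≢j′))) ⟨
    - (sign (suc (toℕ k)) * sign (suc (toℕ (punchOut k≢j′))))  ∎
    where
    j≢k′ = j≢k ∘ ≡.cong suc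
    k≢j′ = k≢j ∘ ≡.cong suc
    drop : ∀ a b → sign (suc a) * sign (suc b) ≈ sign a * sign b
    drop a b = trans (*-cong (sign-suc a) (sign-suc b)) (-x*-y≈x*y (sign a) (sign b))

  module _ {n} (B : Matrix n (2 ℕ.+ n)) where

    pairMinor : (j k : Fin (2 ℕ.+ n)) → j ≢ k → Carrier
    pairMinor j k j≢k = det (λ r s → B r (punchIn j (punchIn (punchOut j≢k) s)))

    -- The coefficient of aⱼ bₖ in the determinant with rows a, b and those of B.
    pairCofactor : (j k : Fin (2 ℕ.+ n)) → Carrier
    pairCofactor j k with j ≟ k
    ... | yes _  = 0#
    ... | no j≢k = sign (toℕ j) * (sign (toℕ (punchOut j≢k)) * pairMinor j k j≢k)

    pairCofactor-diagonal : ∀ j → pairCofactor j j ≈ 0#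
    pairCofactor-diagonal j with j ≟ j
    ... | yes _  = refl
    ... | no j≢j = contradiction ≡.refl j≢j

    pairCofactor-antisym : ∀ j k → pairCofactor j k ≈ - pairCofactor k j
    pairCofactor-antisym j k with j ≟ k | k ≟ j
    ... | yes _   | yes _   = sym -0#≈0#
    ... | yes j≡k | no k≢j  = contradiction (≡.sym j≡k) k≢j
    ... | no j≢k  | yes k≡j = contradiction (≡.sym k≡j) j≢k
    ... | no j≢k  | no k≢j  = begin
      s * (t * pairMinor j k j≢k)      ≈⟨ *-assoc s t _ ⟨
      s * t * pairMinor j k j≢k        ≈⟨ *-cong (sign-punchOut j≢k k≢j)
                                            (det-cong λ r c → reflexive (≡.cong (B r) (punchIn-swap j≢k k≢j c))) ⟩
      - (s′ * t′) * pairMinor k j k≢j  ≈⟨ -‿distribˡ-* _ _ ⟨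
      - (s′ * t′ * pairMinor k j k≢j)  ≈⟨ -‿cong (*-assoc s′ t′ _) ⟩
      - (s′ * (t′ * pairMinor k j k≢j)) ∎
      where
      s  = sign (toℕ j)
      t  = sign (toℕ (punchOut j≢k))
      s′ = sign (toℕ k)
      t′ = sign (toℕ (punchOut k≢j))

    pairCofactor-punchIn : ∀ j l → pairCofactor j (punchIn j l) ≈
      sign (toℕ j) * (sign (toℕ l) * det (λ r s → B r (punchIn j (punchIn l s))))
    pairCofactor-punchIn j l with j ≟ punchIn j l
    ... | yes j≡ = contradiction (≡.sym j≡) (punchInᵢ≢i j l)
    ... | no  j≢ = reflexive (≡.cong
      (λ z → sign (toℕ j) * (sign (toℕ z) * det (λ r s → B r (punchIn j (punchIn z s)))))
      (≡.trans (punchOut-cong j ≡.refl) (punchOut-punchIn j)))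

    -- Expand along the first two rows. The inner sum then omits the column k = j; adding it with
    -- cofactor zero gives a full double sum, in which j and k can trade places.
    det-twoRows : ∀ a b → det (a ∷ b ∷ B) ≈ sum (λ j → sum (λ k → a j * (b k * pairCofactor j k)))
    det-twoRows a b = sum-cong-≋ λ j → begin
      sign (toℕ j) * (a j * sum (λ l → sign (toℕ l) * (b (punchIn j l) * D j l)))
        ≈⟨ x∙yz≈y∙xz _ _ _ ⟩
      a j * (sign (toℕ j) * sum (λ l → sign (toℕ l) * (b (punchIn j l) * D j l)))
        ≈⟨ *-congˡ (*-distribˡ-sum (sign (toℕ j)) (λ l → sign (toℕ l) * (b (punchIn j l) * D j l))) ⟩
      a j * sum (λ l → sign (toℕ j) * (sign (toℕ l) * (b (punchIn j l) * D j l)))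
        ≈⟨ *-congˡ (sum-cong-≋ λ l → term j l) ⟩
      a j * sum (λ l → b (punchIn j l) * pairCofactor j (punchIn j l))
        ≈⟨ *-congˡ (+-identityˡ _) ⟨
      a j * (0# + sum (λ l → b (punchIn j l) * pairCofactor j (punchIn j l)))
        ≈⟨ *-congˡ (+-congʳ (trans (*-congˡ (pairCofactor-diagonal j)) (zeroʳ (b j)))) ⟨
      a j * (b j * pairCofactor j j + sum (λ l → b (punchIn j l) * pairCofactor j (punchIn j l)))
        ≈⟨ *-congˡ (sum-remove {i = j} (λ k → b k * pairCofactor j k)) ⟨
      a j * sum (λ k → b k * pairCofactor j k)
        ≈⟨ *-distribˡ-sum (a j) (λ k → b k * pairCofactor j k) ⟩
      sum (λ k → a j * (b k * pairCofactor j k)) ∎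
      where
      D : (j : Fin (2 ℕ.+ n)) (l : Fin (suc n)) → Carrier
      D j l = det (λ r s → B r (punchIn j (punchIn l s)))
      term : ∀ j l → sign (toℕ j) * (sign (toℕ l) * (b (punchIn j l) * D j l)) ≈
                     b (punchIn j l) * pairCofactor j (punchIn j l)
      term j l = begin
        sign (toℕ j) * (sign (toℕ l) * (b (punchIn j l) * D j l))  ≈⟨ *-congˡ (x∙yz≈y∙xz _ _ _) ⟩
        sign (toℕ j) * (b (punchIn j l) * (sign (toℕ l) * D j l))  ≈⟨ x∙yz≈y∙xz _ _ _ ⟩
        b (punchIn j l) * (sign (toℕ j) * (sign (toℕ l) * D j l))  ≈⟨ *-congˡ (pairCofactor-punchIn j l) ⟨
        b (punchIn j l) * pairCofactor j (punchIn j l)             ∎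

    -- The product of the two entries is symmetric in j and k, the cofactor is alternating.
    det-equalRows₀₁ : ∀ a → det (a ∷ a ∷ B) ≈ 0#
    det-equalRows₀₁ a = trans (det-twoRows a a) (sum-alternating _
      (λ j → trans (*-congˡ (trans (*-congˡ (pairCofactor-diagonal j)) (zeroʳ _))) (zeroʳ _))
      (λ j k → begin
        a j * (a k * pairCofactor j k) + a k * (a j * pairCofactor k j)
          ≈⟨ +-cong (x∙yz≈y∙xz _ _ _) (*-congˡ (*-congˡ (pairCofactor-antisym k j))) ⟩
        a k * (a j * pairCofactor j k) + a k * (a j * - pairCofactor j k)
          ≈⟨ distribˡ _ _ _ ⟨
        a k * (a j * pairCofactor j k + a j * - pairCofactor j k)
          ≈⟨ *-congˡ (distribˡ _ _ _) ⟨
        a k * (a j * (pairCofactor j k + - pairCofactor j k))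
          ≈⟨ *-congˡ (*-congˡ (-‿inverseʳ _)) ⟩
        a k * (a j * 0#)  ≈⟨ *-congˡ (zeroʳ _) ⟩
        a k * 0#          ≈⟨ zeroʳ _ ⟩
        0#                ∎))

    det-swap₀₁ : ∀ a b → det (a ∷ b ∷ B) ≈ - det (b ∷ a ∷ B)
    det-swap₀₁ a b = begin
      det (a ∷ b ∷ B)                                               ≈⟨ det-twoRows a b ⟩
      sum (λ j → sum (λ k → a j * (b k * pairCofactor j k)))        ≈⟨ ∑-comm (λ j k → a j * (b k * pairCofactor j k)) ⟩
      sum (λ k → sum (λ j → a j * (b k * pairCofactor j k)))        ≈⟨ sum-cong-≋ (λ k → sum-cong-≋ (λ j → term j k)) ⟩
      sum (λ k → sum (λ j → - ba k j))                              ≈⟨ sum-cong-≋ {2 ℕ.+ n} (λ k → sum-negate (ba k)) ⟩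
      sum (λ k → - sum (λ j → ba k j))                              ≈⟨ sum-negate (λ k → sum (ba k)) ⟩
      - sum (λ k → sum (λ j → b k * (a j * pairCofactor k j)))      ≈⟨ -‿cong (det-twoRows b a) ⟨
      - det (b ∷ a ∷ B)                                             ∎
      where
      ba : Matrix (2 ℕ.+ n) (2 ℕ.+ n)
      ba k j = b k * (a j * pairCofactor k j)
      term : ∀ j k → a j * (b k * pairCofactor j k) ≈ - (b k * (a j * pairCofactor k j))
      term j k = begin
        a j * (b k * pairCofactor j k)      ≈⟨ x∙yz≈y∙xz _ _ _ ⟩
        b k * (a j * pairCofactor j k)      ≈⟨ *-congˡ (*-congˡ (pairCofactor-antisym j k)) ⟩
        b k * (a j * - pairCofactor k j)    ≈⟨ *-congˡ (-‿distribʳ-* _ _) ⟨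
        b k * - (a j * pairCofactor k j)    ≈⟨ -‿distribʳ-* _ _ ⟨
        - (b k * (a j * pairCofactor k j))  ∎

  rows∷ : ∀ {m n} (A : Matrix (suc m) n) → ∀ i j → A i j ≈ (A zero ∷ (A ∘ suc)) i j
  rows∷ A zero    j = refl
  rows∷ A (suc i) j = refl

  rows∷∷ : ∀ {m n} (A : Matrix (2 ℕ.+ m) n) → ∀ i j →
           A i j ≈ (A zero ∷ A (suc zero) ∷ λ r → A (suc (suc r))) i j
  rows∷∷ A zero          j = refl
  rows∷∷ A (suc zero)    j = refl
  rows∷∷ A (suc (suc i)) j = refl

  tail₂ : ∀ {m n} → Matrix (2 ℕ.+ m) n → Matrix m n
  tail₂ A i = A (suc (suc i))

  det-zero-minors : ∀ {n} (A : Matrix (suc n) (suc n)) →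
                    (∀ j → det (minor zero j A) ≈ 0#) → det A ≈ 0#
  det-zero-minors A z = sum-zero λ j →
    trans (*-congˡ {sign (toℕ j)} (trans (*-congˡ {A zero j} (z j)) (zeroʳ _))) (zeroʳ _)

  -- If the copy of row 0 is not row 1, swap these two rows: row 0 now lies below the row of
  -- expansion, so both copies appear in every minor and the induction applies.
  det-repeatedRow : ∀ {n} (A : Matrix (suc n) (suc n)) (i : Fin n) →
                    (∀ j → A zero j ≈ A (suc i) j) → det A ≈ 0#
  det-repeatedRow {suc n} A zero    eq = trans
    (det-cong {A = A} {B = A zero ∷ A zero ∷ tail₂ A}
       λ { zero          j → refl
         ; (suc zero)    j → sym (eq j)
         ; (suc (suc i)) j → refl })
    (det-equalRows₀₁ (tail₂ A) (A zero))
  det-repeatedRow {suc n} A (suc i) eq = begin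
    det A                                             ≈⟨ det-cong {A = A} (rows∷∷ A) ⟩
    det (A zero ∷ A (suc zero) ∷ tail₂ A)     ≈⟨ det-swap₀₁ (tail₂ A) (A zero) (A (suc zero)) ⟩
    - det (A (suc zero) ∷ A zero ∷ tail₂ A)
      ≈⟨ -‿cong (det-zero-minors B λ j → det-repeatedRow (minor zero j B) i (λ l → eq (punchIn j l))) ⟩
    - 0#                                              ≈⟨ -0#≈0# ⟩
    0#                                                ∎
    where B = A (suc zero) ∷ A zero ∷ tail₂ A

  -- One swap brings `A zero` back to the top and gives one sign; expanding along it, the row has i
  -- places left to move in each minor.
  det-moveRow : ∀ {n} (A : Matrix (suc n) (suc n)) (i : Fin (suc n)) →
                det (A i ∷ (A ∘ punchIn i)) ≈ sign (toℕ i) * det A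
  det-moveRow         A zero    = trans (det-cong {B = A} λ r s → sym (rows∷ A r s)) (sym (*-identityˡ _))
  det-moveRow {suc n} A (suc i) = begin
    det (A (suc i) ∷ (A ∘ punchIn (suc i)))
      ≈⟨ det-cong {A = A (suc i) ∷ (A ∘ punchIn (suc i))} {B = A (suc i) ∷ A zero ∷ rest}
           (λ { zero j → refl ; (suc zero) j → refl ; (suc (suc r)) j → refl }) ⟩
    det (A (suc i) ∷ A zero ∷ rest)
      ≈⟨ det-swap₀₁ rest (A (suc i)) (A zero) ⟩
    - det (A zero ∷ A (suc i) ∷ rest)
      ≈⟨ -‿cong (sum-cong-≋ λ j → *-congˡ {sign (toℕ j)} (*-congˡ {A zero j} (begin
           det (minor zero j (A zero ∷ A (suc i) ∷ rest))
             ≈⟨ det-cong {A = minor zero j (A zero ∷ A (suc i) ∷ rest)}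
                         {B = minor zero j A i ∷ (minor zero j A ∘ punchIn i)}
                  (λ { zero s → refl ; (suc r) s → refl }) ⟩
           det (minor zero j A i ∷ (minor zero j A ∘ punchIn i))
             ≈⟨ det-moveRow (minor zero j A) i ⟩
           sign (toℕ i) * det (minor zero j A) ∎))) ⟩
    - sum (λ j → sign (toℕ j) * (A zero j * (sign (toℕ i) * det (minor zero j A))))
      ≈⟨ -‿cong (sum-cong-≋ λ j → trans (*-congˡ (x∙yz≈y∙xz (A zero j) (sign (toℕ i)) (det (minor zero j A))))
                                        (x∙yz≈y∙xz (sign (toℕ j)) (sign (toℕ i)) (A zero j * det (minor zero j A)))) ⟩
    - sum (λ j → sign (toℕ i) * (sign (toℕ j) * (A zero j * det (minor zero j A))))
      ≈⟨ -‿cong (*-distribˡ-sum (sign (toℕ i)) (λ j → sign (toℕ j) * (A zero j * det (minor zero j A)))) ⟨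
    - (sign (toℕ i) * det A)
      ≈⟨ -‿distribˡ-* _ _ ⟩
    - sign (toℕ i) * det A
      ≈⟨ *-congʳ (sign-suc (toℕ i)) ⟨
    sign (suc (toℕ i)) * det A ∎
    where
    rest : Matrix n (2 ℕ.+ n)
    rest r = A (suc (punchIn i r))

  -- Column i of the adjugate is built from the minors without row i, which are the first-row minors
  -- of the matrix with `a` on top of the remaining rows.
  cofactorExpansion : ∀ {n} (A : Matrix (suc n) (suc n)) a i →
                      sum (λ j → a j * adjugate A j i) ≈ sign (toℕ i) * det (a ∷ (A ∘ punchIn i))
  cofactorExpansion A a i = begin
    sum (λ j → a j * (sign (toℕ j ℕ.+ toℕ i) * det (minor i j A)))
      ≈⟨ sum-cong-≋ (λ j → begin
        a j * (sign (toℕ j ℕ.+ toℕ i) * det (minor i j A))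
          ≈⟨ x∙yz≈y∙xz _ _ _ ⟩
        sign (toℕ j ℕ.+ toℕ i) * (a j * det (minor i j A))
          ≈⟨ *-congʳ (trans (sign-+ (toℕ j) (toℕ i)) (*-comm _ _)) ⟩
        sign (toℕ i) * sign (toℕ j) * (a j * det (minor i j A))
          ≈⟨ *-assoc _ _ _ ⟩
        sign (toℕ i) * (sign (toℕ j) * (a j * det (minor i j A))) ∎) ⟩
    sum (λ j → sign (toℕ i) * (sign (toℕ j) * (a j * det (minor i j A))))
      ≈⟨ *-distribˡ-sum (sign (toℕ i)) (λ j → sign (toℕ j) * (a j * det (minor i j A))) ⟨
    sign (toℕ i) * det (a ∷ (A ∘ punchIn i)) ∎

  -- Expanding row i against the cofactors of row i′ gives a matrix that repeats row i unless i =
  -- i′; in that case moving the row back cancels the sign.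
  *-adjugate : ∀ {n} (A : Matrix n n) i i′ → sum (λ j → A i j * adjugate A j i′) ≈ det A * 𝟙 i i′
  *-adjugate {suc n} A i i′ with i ≟ i′
  ... | yes ≡.refl = begin
    sum (λ j → A i j * adjugate A j i)                 ≈⟨ cofactorExpansion A (A i) i ⟩
    sign (toℕ i) * det (A i ∷ (A ∘ punchIn i))         ≈⟨ *-congˡ (det-moveRow A i) ⟩
    sign (toℕ i) * (sign (toℕ i) * det A)              ≈⟨ *-assoc _ _ _ ⟨
    sign (toℕ i) * sign (toℕ i) * det A                ≈⟨ *-congʳ (sign² (toℕ i)) ⟩
    1# * det A                                         ≈⟨ *-comm 1# (det A) ⟩
    det A * 1#                                         ∎
  ... | no i≢i′ = begin
    sum (λ j → A i j * adjugate A j i′)                ≈⟨ cofactorExpansion A (A i) i′ ⟩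
    sign (toℕ i′) * det (A i ∷ (A ∘ punchIn i′))
      ≈⟨ *-congˡ (det-repeatedRow (A i ∷ (A ∘ punchIn i′)) (punchOut i′≢i) (λ j →
           reflexive (≡.cong (λ z → A z j) (≡.sym (punchIn-punchOut i′≢i))))) ⟩
    sign (toℕ i′) * 0#                                 ≈⟨ zeroʳ _ ⟩
    0#                                                 ≈⟨ zeroʳ _ ⟨
    det A * 0#                                         ∎
    where i′≢i = i≢i′ ∘ ≡.sym

  -- Iverson brackets, turning degrees, adjacency and incidence into ring elements

  ⟦_⟧ : ∀ {a} {P : Set a} → Dec P → Carrier
  ⟦ P? ⟧ = if does P? then 1# else 0#

  ⟦⟧-cong : ∀ {a b} {P : Set a} {Q : Set b} → P ⇔ Q → (P? : Dec P) (Q? : Dec Q) → ⟦ P? ⟧ ≈ ⟦ Q? ⟧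
  ⟦⟧-cong P⇔Q P? Q? = reflexive (≡.cong (if_then 1# else 0#) (does-⇔ P⇔Q P? Q?))

  ⟦⟧-false : ∀ {a} {P : Set a} (P? : Dec P) → ¬ P → ⟦ P? ⟧ ≈ 0#
  ⟦⟧-false P? ¬p = reflexive (≡.cong (if_then 1# else 0#) (dec-false P? ¬p))

  ⟦⟧-× : ∀ {a b} {P : Set a} {Q : Set b} (P? : Dec P) (Q? : Dec Q) → ⟦ P? ×-dec Q? ⟧ ≈ ⟦ P? ⟧ * ⟦ Q? ⟧
  ⟦⟧-× P? Q? with does P?
  ... | true  = sym (*-identityˡ _)
  ... | false = sym (zeroˡ _)

  ⟦⟧-⊎ : ∀ {a b} {P : Set a} {Q : Set b} (P? : Dec P) (Q? : Dec Q) → ¬ (P × Q) →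
         ⟦ P? ⊎-dec Q? ⟧ ≈ ⟦ P? ⟧ + ⟦ Q? ⟧
  ⟦⟧-⊎ (yes p) Q? ¬pq = trans (sym (+-identityʳ 1#)) (+-congˡ (sym (⟦⟧-false Q? λ q → ¬pq (p , q))))
  ⟦⟧-⊎ (no _)  Q? ¬pq = sym (+-identityˡ _)

  sum-δ : ∀ {n} (i : Fin n) (f : Fin n → Carrier) → sum (λ j → ⟦ i ≟ j ⟧ * f j) ≈ f i
  sum-δ zero    f = trans (+-cong (*-identityˡ _) (sum-zero λ j → zeroˡ (f (suc j)))) (+-identityʳ _)
  sum-δ (suc i) f = trans (+-cong (zeroˡ _) (sum-δ i (f ∘ suc))) (+-identityˡ _)

  sum-⟦≟⟧ : ∀ {n} (i : Fin n) → sum (λ j → ⟦ i ≟ j ⟧) ≈ 1#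
  sum-⟦≟⟧ i = trans (sum-cong-≋ λ j → sym (*-identityʳ ⟦ i ≟ j ⟧)) (sum-δ i (const 1#))

  -- Uniqueness turns a count into a question of existence: given a witness i, the bracket at j is
  -- that of i = j.
  sum-⟦⟧ : ∀ {n p} {P : Fin n → Set p} (P? : ∀ i → Dec (P i)) →
           (∀ {i j} → P i → P j → i ≡ j) → sum (λ i → ⟦ P? i ⟧) ≈ ⟦ any? P? ⟧
  sum-⟦⟧ {P = P} P? unique with any? P?
  ... | yes (i , p) = trans
    (sum-cong-≋ λ j → ⟦⟧-cong (mk⇔ (unique p) (λ i≡j → ≡.subst P i≡j p)) (P? j) (i ≟ j)) (sum-⟦≟⟧ i)
  ... | no ∄        = sum-zero λ i → ⟦⟧-false (P? i) λ p → ∄ (i , p)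

  diagonal-⟦⟧ : ∀ {n} (d : Fin n → Carrier) i j → diagonal d i j ≈ ⟦ i ≟ j ⟧ * d i
  diagonal-⟦⟧ d i j with i ≟ j
  ... | yes _ = sym (*-identityˡ (d i))
  ... | no _  = sym (zeroˡ (d i))

  𝟙-⟦⟧ : ∀ {n} (i j : Fin n) → 𝟙 i j ≈ ⟦ i ≟ j ⟧
  𝟙-⟦⟧ i j = trans (diagonal-⟦⟧ (const 1#) i j) (*-identityʳ _)

  𝟙-sym : ∀ {n} (i j : Fin n) → 𝟙 i j ≈ 𝟙 {n} j i
  𝟙-sym i j = trans (𝟙-⟦⟧ i j) (trans (⟦⟧-cong (mk⇔ ≡.sym ≡.sym) (i ≟ j) (j ≟ i)) (sym (𝟙-⟦⟧ j i)))

  det-𝟙 : ∀ n → det {n} 𝟙 ≈ 1#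
  det-𝟙 zero    = refl
  det-𝟙 (suc n) = trans
    (+-cong
      (trans (*-identityˡ _) (trans (*-identityˡ _) (trans
        (det-cong {n} λ i j → trans (𝟙-⟦⟧ (suc i) (suc j)) (sym (𝟙-⟦⟧ i j))) (det-𝟙 n))))
      (sum-zero {n} λ j → trans (*-congˡ {sign (suc (toℕ j))} (zeroˡ (det (minor zero (suc j) 𝟙)))) (zeroʳ _)))
    (+-identityʳ 1#)

  -- Determinants of block matrices

  -- In the first row only columns of the left block contribute, and deleting such a column leaves a
  -- matrix of the same shape with the same lower right block.
  det-lowerBlock : ∀ n {m} (A : Matrix (n ℕ.+ m) (n ℕ.+ m)) →
                   (∀ i j → A (i ↑ˡ m) (n ↑ʳ j) ≈ 0#) →
                   det A ≈ det (λ i j → A (i ↑ˡ m) (j ↑ˡ m)) * det (λ i j → A (n ↑ʳ i) (n ↑ʳ j))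
  det-lowerBlock zero        A A≈0 = sym (*-identityˡ (det A))
  det-lowerBlock (suc n) {m} A A≈0 = begin
    det A
      ≈⟨ sum-++ (suc n) term ⟩
    sum (λ j → term (j ↑ˡ m)) + sum (λ l → term (suc n ↑ʳ l))
      ≈⟨ +-cong (sum-cong-≋ {suc n} left) (sum-zero right) ⟩
    sum (λ j → sign (toℕ j) * (S zero j * det (minor zero j S)) * det D) + 0#
      ≈⟨ +-identityʳ _ ⟩
    sum (λ j → sign (toℕ j) * (S zero j * det (minor zero j S)) * det D)
      ≈⟨ *-distribʳ-sum (det D) (λ j → sign (toℕ j) * (S zero j * det (minor zero j S))) ⟨
    det S * det D ∎
    where
    S : Matrix (suc n) (suc n)
    S i j = A (i ↑ˡ m) (j ↑ˡ m)
    D : Matrix m m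
    D i j = A (suc n ↑ʳ i) (suc n ↑ʳ j)
    term : Fin (suc n ℕ.+ m) → Carrier
    term j = sign (toℕ j) * (A zero j * det (minor zero j A))
    right : ∀ l → term (suc n ↑ʳ l) ≈ 0#
    right l = trans (*-congˡ {sign (toℕ (suc n ↑ʳ l))} (trans (*-congʳ (A≈0 zero l)) (zeroˡ _))) (zeroʳ _)
    minor-A : ∀ j → det (minor zero (j ↑ˡ m) A) ≈ det (minor zero j S) * det D
    minor-A j = begin
      det (minor zero (j ↑ˡ m) A)
        ≈⟨ det-lowerBlock n (minor zero (j ↑ˡ m) A)
             (λ r l → trans (reflexive (≡.cong (A (suc (r ↑ˡ m))) (punchIn-↑ʳ j l))) (A≈0 (suc r) l)) ⟩
      det (λ r s → A (suc (r ↑ˡ m)) (punchIn (j ↑ˡ m) (s ↑ˡ m))) *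
      det (λ r s → A (suc (n ↑ʳ r)) (punchIn (j ↑ˡ m) (n ↑ʳ s)))
        ≈⟨ *-cong (det-cong {n} λ r s → reflexive (≡.cong (A (suc (r ↑ˡ m))) (punchIn-↑ˡ j s)))
                  (det-cong {m} λ r s → reflexive (≡.cong (A (suc (n ↑ʳ r))) (punchIn-↑ʳ j s))) ⟩
      det (minor zero j S) * det D ∎
    left : ∀ j → term (j ↑ˡ m) ≈ sign (toℕ j) * (S zero j * det (minor zero j S)) * det D
    left j = begin
      sign (toℕ (j ↑ˡ m)) * (S zero j * det (minor zero (j ↑ˡ m) A))
        ≈⟨ *-cong (reflexive (≡.cong sign (toℕ-↑ˡ j m))) (*-congˡ {S zero j} (minor-A j)) ⟩
      sign (toℕ j) * (S zero j * (det (minor zero j S) * det D))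
        ≈⟨ *-congˡ (*-assoc (S zero j) _ _) ⟨
      sign (toℕ j) * (S zero j * det (minor zero j S) * det D)
        ≈⟨ *-assoc (sign (toℕ j)) _ _ ⟨
      sign (toℕ j) * (S zero j * det (minor zero j S)) * det D ∎

  -- After induction on the minors, the surplus in the first row contributes, for each l, a multiple
  -- of a determinant whose first row repeats the lower row l. The hypotheses hold column by column,
  -- so minors inherit them whichever column is deleted.
  det-addRows : ∀ n {m} (A A′ : Matrix (n ℕ.+ m) (n ℕ.+ m)) (W : Matrix n m) →
                (∀ i j → A′ (i ↑ˡ m) j ≈ A (i ↑ˡ m) j + sum (λ l → W i l * A (n ↑ʳ l) j)) →
                (∀ l j → A′ (n ↑ʳ l) j ≈ A (n ↑ʳ l) j) →
                det A′ ≈ det A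
  det-addRows zero        A A′ W top bottom = det-cong bottom
  det-addRows (suc n) {m} A A′ W top bottom = begin
    det A′
      ≈⟨ sum-cong-≋ {suc n ℕ.+ m} step ⟩
    sum (λ j → s j * (A zero j * d j) + sum (λ l → W zero l * (s j * (b l j * d j))))
      ≈⟨ ∑-distrib-+ (λ j → s j * (A zero j * d j)) (λ j → sum (λ l → W zero l * (s j * (b l j * d j)))) ⟩
    det A + sum (λ j → sum (λ l → W zero l * (s j * (b l j * d j))))
      ≈⟨ +-congˡ {det A} (∑-comm (λ j l → W zero l * (s j * (b l j * d j)))) ⟩
    det A + sum (λ l → sum (λ j → W zero l * (s j * (b l j * d j))))
      ≈⟨ +-congˡ {det A} (sum-zero repeated) ⟩
    det A + 0#
      ≈⟨ +-identityʳ (det A) ⟩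
    det A ∎
    where
    s d : Fin (suc n ℕ.+ m) → Carrier
    s j = sign (toℕ j)
    d j = det (minor zero j A)
    b : Matrix m (suc n ℕ.+ m)
    b l = A (suc n ↑ʳ l)
    step : ∀ j → s j * (A′ zero j * det (minor zero j A′)) ≈
                 s j * (A zero j * d j) + sum (λ l → W zero l * (s j * (b l j * d j)))
    step j = begin
      s j * (A′ zero j * det (minor zero j A′))
        ≈⟨ *-congˡ (*-cong (top zero j)
             (det-addRows n (minor zero j A) (minor zero j A′) (W ∘ suc)
                (λ r t → top (suc r) (punchIn j t)) (λ l t → bottom l (punchIn j t)))) ⟩
      s j * ((A zero j + sum (λ l → W zero l * b l j)) * d j)
        ≈⟨ *-congˡ (distribʳ (d j) (A zero j) _) ⟩
      s j * (A zero j * d j + sum (λ l → W zero l * b l j) * d j)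
        ≈⟨ distribˡ (s j) _ _ ⟩
      s j * (A zero j * d j) + s j * (sum (λ l → W zero l * b l j) * d j)
        ≈⟨ +-congˡ (*-congˡ (*-distribʳ-sum (d j) (λ l → W zero l * b l j))) ⟩
      s j * (A zero j * d j) + s j * sum (λ l → W zero l * b l j * d j)
        ≈⟨ +-congˡ (*-distribˡ-sum (s j) (λ l → W zero l * b l j * d j)) ⟩
      s j * (A zero j * d j) + sum (λ l → s j * (W zero l * b l j * d j))
        ≈⟨ +-congˡ (sum-cong-≋ λ l → trans (*-congˡ (*-assoc (W zero l) (b l j) (d j)))
                                           (x∙yz≈y∙xz (s j) (W zero l) (b l j * d j))) ⟩
      s j * (A zero j * d j) + sum (λ l → W zero l * (s j * (b l j * d j))) ∎
    repeated : ∀ l → sum (λ j → W zero l * (s j * (b l j * d j))) ≈ 0#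
    repeated l = begin
      sum (λ j → W zero l * (s j * (b l j * d j)))
        ≈⟨ *-distribˡ-sum (W zero l) (λ j → s j * (b l j * d j)) ⟨
      W zero l * det (b l ∷ (A ∘ suc))
        ≈⟨ *-congˡ (det-repeatedRow (b l ∷ (A ∘ suc)) (n ↑ʳ l) (λ j → refl)) ⟩
      W zero l * 0#
        ≈⟨ zeroʳ (W zero l) ⟩
      0# ∎

  -- The rows of W are those of B D⁻¹, where B and D are the right blocks of A.
  det-schur : ∀ n {m} (A : Matrix (n ℕ.+ m) (n ℕ.+ m)) (W : Matrix n m) →
              (∀ i j → sum (λ l → W i l * A (n ↑ʳ l) (n ↑ʳ j)) ≈ A (i ↑ˡ m) (n ↑ʳ j)) →
              det A ≈ det (λ i j → A (i ↑ˡ m) (j ↑ˡ m) + - sum (λ l → W i l * A (n ↑ʳ l) (j ↑ˡ m))) *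
                      det (λ i j → A (n ↑ʳ i) (n ↑ʳ j))
  det-schur n {m} A W WD≈B = begin
    det A    ≈⟨ det-addRows n A A′ (λ i l → - W i l) top bottom ⟨
    det A′   ≈⟨ det-lowerBlock n A′ corner≈0 ⟩
    det (λ i j → A′ (i ↑ˡ m) (j ↑ˡ m)) * det (λ i j → A′ (n ↑ʳ i) (n ↑ʳ j))
      ≈⟨ *-cong (det-cong {n} λ i j → reduced i (j ↑ˡ m)) (det-cong {m} λ l j → bottom l (n ↑ʳ j)) ⟩
    det (λ i j → A (i ↑ˡ m) (j ↑ˡ m) + - sum (λ l → W i l * A (n ↑ʳ l) (j ↑ˡ m))) *
    det (λ i j → A (n ↑ʳ i) (n ↑ʳ j)) ∎
    where
    A′ : Matrix (n ℕ.+ m) (n ℕ.+ m)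
    A′ i j = [ (λ a → A (a ↑ˡ m) j + - sum (λ l → W a l * A (n ↑ʳ l) j)) , (λ l → A (n ↑ʳ l) j) ]′ (splitAt n i)
    reduced : ∀ i j → A′ (i ↑ˡ m) j ≈ A (i ↑ˡ m) j + - sum (λ l → W i l * A (n ↑ʳ l) j)
    reduced i j = reflexive (≡.cong [ _ , _ ]′ (splitAt-↑ˡ n i m))
    bottom : ∀ l j → A′ (n ↑ʳ l) j ≈ A (n ↑ʳ l) j
    bottom l j = reflexive (≡.cong [ _ , _ ]′ (splitAt-↑ʳ n m l))
    top : ∀ i j → A′ (i ↑ˡ m) j ≈ A (i ↑ˡ m) j + sum (λ l → - W i l * A (n ↑ʳ l) j)
    top i j = trans (reduced i j) (+-congˡ (sym (trans
      (sum-cong-≋ λ l → sym (-‿distribˡ-* (W i l) (A (n ↑ʳ l) j)))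
      (sum-negate (λ l → W i l * A (n ↑ʳ l) j)))))
    corner≈0 : ∀ i j → A′ (i ↑ˡ m) (n ↑ʳ j) ≈ 0#
    corner≈0 i j = trans (reduced i (n ↑ʳ j)) (trans (+-congˡ (-‿cong (WD≈B i j))) (-‿inverseʳ _))

  -- `combine` lists the indices of the first block before all others, so `det-lowerBlock` splits
  -- off one factor at a time.
  det-blockDiagonal : ∀ k {h} (A : Matrix (k ℕ.* h) (k ℕ.* h)) (N : Matrix h h) →
                      (∀ i j i′ j′ → A (combine {k} i j) (combine {k} i′ j′) ≈ ⟦ i ≟ i′ ⟧ * N j j′) →
                      det A ≈ det N ^ k
  det-blockDiagonal zero        A N A≈ = refl
  det-blockDiagonal (suc k) {h} A N A≈ = begin
    det A
      ≈⟨ det-lowerBlock h A upper≈0 ⟩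
    det (λ i j → A (i ↑ˡ (k ℕ.* h)) (j ↑ˡ (k ℕ.* h))) * det (λ i j → A (h ↑ʳ i) (h ↑ʳ j))
      ≈⟨ *-cong (det-cong {h} λ i j → trans (A≈ zero i zero j) (*-identityˡ _))
                (det-blockDiagonal k (λ i j → A (h ↑ʳ i) (h ↑ʳ j)) N (λ i j i′ j′ → A≈ (suc i) j (suc i′) j′)) ⟩
    det N * det N ^ k ∎
    where
    upper≈0 : ∀ i j → A (i ↑ˡ (k ℕ.* h)) (h ↑ʳ j) ≈ 0#
    upper≈0 i j with combine-surjective {k} j
    ... | i′ , j′ , ≡.refl = trans (A≈ zero i (suc i′) j′) (zeroˡ _)

  -- The vector N⁻¹ 𝟏 when δ is inverse to det N; its entries add up to the coronal.
  rowSums : ∀ {n} → Carrier → Matrix n n → Fin n → Carrier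
  rowSums δ N i = sum (λ j → (δ ⊡ adjugate N) i j)

  -- By symmetry it suffices that N ⋅ N⁻¹ 𝟏 = 𝟏.
  rowSums-* : ∀ {n} (N : Matrix n n) δ → det N * δ ≈ 1# → (∀ i j → N i j ≈ N j i) →
              ∀ t → sum (λ j → rowSums δ N j * N j t) ≈ 1#
  rowSums-* N δ Nδ≈1 N-sym t = begin
    sum (λ j → rowSums δ N j * N j t)
      ≈⟨ sum-cong-≋ (λ j → begin
           rowSums δ N j * N j t
             ≈⟨ *-comm _ _ ⟩
           N j t * rowSums δ N j
             ≈⟨ *-congʳ (N-sym j t) ⟩
           N t j * rowSums δ N j
             ≈⟨ *-distribˡ-sum (N t j) (λ l → δ * adjugate N j l) ⟩
           sum (λ l → N t j * (δ * adjugate N j l))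
             ≈⟨ sum-cong-≋ (λ l → x∙yz≈y∙xz (N t j) δ (adjugate N j l)) ⟩
           sum (λ l → δ * (N t j * adjugate N j l)) ∎) ⟩
    sum (λ j → sum (λ l → δ * (N t j * adjugate N j l)))
      ≈⟨ ∑-comm (λ j l → δ * (N t j * adjugate N j l)) ⟩
    sum (λ l → sum (λ j → δ * (N t j * adjugate N j l)))
      ≈⟨ sum-cong-≋ (λ l → *-distribˡ-sum δ (λ j → N t j * adjugate N j l)) ⟨
    sum (λ l → δ * sum (λ j → N t j * adjugate N j l))
      ≈⟨ sum-cong-≋ (λ l → begin
           δ * sum (λ j → N t j * adjugate N j l)  ≈⟨ *-congˡ (*-adjugate N t l) ⟩
           δ * (det N * 𝟙 t l)                     ≈⟨ *-assoc δ (det N) (𝟙 t l) ⟨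
           δ * det N * 𝟙 t l                       ≈⟨ *-cong (trans (*-comm δ (det N)) Nδ≈1) (𝟙-⟦⟧ t l) ⟩
           1# * ⟦ t ≟ l ⟧                          ≈⟨ *-identityˡ _ ⟩
           ⟦ t ≟ l ⟧                               ∎) ⟩
    sum (λ l → ⟦ t ≟ l ⟧)
      ≈⟨ sum-⟦≟⟧ t ⟩
    1# ∎

  -- The Schur complement of the diagonal blocks N; the row of B N⁻¹ belonging to a
  -- block is a multiple of the row 𝟏ᵀ N⁻¹, which by symmetry of N consists of row sums.
  module _ {n k h} (A : Matrix (n ℕ.+ k ℕ.* h) (n ℕ.+ k ℕ.* h)) (B : Matrix n k) (N : Matrix h h) (δ : Carrier)
    (Nδ≈1 : det N * δ ≈ 1#) (N-sym : ∀ i j → N i j ≈ N j i)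
    (upper : ∀ a i j → A (a ↑ˡ (k ℕ.* h)) (n ↑ʳ combine {k} i j) ≈ - B a i)
    (lower : ∀ a i j → A (n ↑ʳ combine {k} i j) (a ↑ˡ (k ℕ.* h)) ≈ - B a i)
    (diag  : ∀ i j i′ j′ → A (n ↑ʳ combine {k} i j) (n ↑ʳ combine {k} i′ j′) ≈ ⟦ i ≟ i′ ⟧ * N j j′) where

    private
      Γ = sum (rowSums δ N)

      base : Fin n → Fin (n ℕ.+ k ℕ.* h)
      base = _↑ˡ (k ℕ.* h)

      new : Fin k → Fin h → Fin (n ℕ.+ k ℕ.* h)
      new i j = n ↑ʳ combine i j

      W : Matrix n (k ℕ.* h)
      W a l = - B a (quotient h l) * rowSums δ N (remainder {k} h l)

      W-combine : ∀ a i j → W a (combine i j) ≈ - B a i * rowSums δ N j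
      W-combine a i j = reflexive (≡.cong (λ (i , j) → - B a i * rowSums δ N j) (remQuot-combine i j))

      sum-W : ∀ a (f : Fin (n ℕ.+ k ℕ.* h) → Carrier) → sum (λ l → W a l * f (n ↑ʳ l)) ≈
              sum (λ i → - B a i * sum (λ j → rowSums δ N j * f (new i j)))
      sum-W a f = begin
        sum (λ l → W a l * f (n ↑ʳ l))
          ≈⟨ sum-combine k (λ l → W a l * f (n ↑ʳ l)) ⟩
        sum (λ i → sum (λ j → W a (combine i j) * f (new i j)))
          ≈⟨ sum-cong-≋ (λ i → trans
               (sum-cong-≋ λ j → trans (*-congʳ (W-combine a i j)) (*-assoc _ _ _))
               (sym (*-distribˡ-sum (- B a i) (λ j → rowSums δ N j * f (new i j))))) ⟩
        sum (λ i → - B a i * sum (λ j → rowSums δ N j * f (new i j))) ∎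

      W-solves′ : ∀ a i j → sum (λ l → W a l * A (n ↑ʳ l) (new i j)) ≈ A (base a) (new i j)
      W-solves′ a i j = begin
        sum (λ l → W a l * A (n ↑ʳ l) (new i j))
          ≈⟨ sum-W a (λ s → A s (new i j)) ⟩
        sum (λ i′ → - B a i′ * sum (λ j′ → rowSums δ N j′ * A (new i′ j′) (new i j)))
          ≈⟨ sum-cong-≋ (λ i′ → begin
               - B a i′ * sum (λ j′ → rowSums δ N j′ * A (new i′ j′) (new i j))
                 ≈⟨ *-congˡ (sum-cong-≋ λ j′ → trans (*-congˡ (diag i′ j′ i j)) (x∙yz≈y∙xz _ _ _)) ⟩
               - B a i′ * sum (λ j′ → ⟦ i′ ≟ i ⟧ * (rowSums δ N j′ * N j′ j))
                 ≈⟨ *-congˡ (*-distribˡ-sum ⟦ i′ ≟ i ⟧ (λ j′ → rowSums δ N j′ * N j′ j)) ⟨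
               - B a i′ * (⟦ i′ ≟ i ⟧ * sum (λ j′ → rowSums δ N j′ * N j′ j))
                 -- The row 𝟏ᵀ N⁻¹ times N is 𝟏ᵀ again, so the result does not depend on the vertex
                 -- j within the pocket, like the block to be matched.
                 ≈⟨ *-congˡ (trans (*-congˡ (rowSums-* N δ Nδ≈1 N-sym j)) (*-identityʳ _)) ⟩
               - B a i′ * ⟦ i′ ≟ i ⟧
                 ≈⟨ trans (*-comm _ _) (*-congʳ (⟦⟧-cong (mk⇔ ≡.sym ≡.sym) (i′ ≟ i) (i ≟ i′))) ⟩
               ⟦ i ≟ i′ ⟧ * - B a i′ ∎) ⟩
        sum (λ i′ → ⟦ i ≟ i′ ⟧ * - B a i′)
          ≈⟨ sum-δ i (λ i′ → - B a i′) ⟩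
        - B a i
          ≈⟨ upper a i j ⟨
        A (base a) (new i j) ∎

      W-solves : ∀ a t → sum (λ l → W a l * A (n ↑ʳ l) (n ↑ʳ t)) ≈ A (base a) (n ↑ʳ t)
      W-solves a t with combine-surjective {k} t
      ... | i , j , ≡.refl = W-solves′ a i j

      sum-W-base : ∀ a b → sum (λ l → W a l * A (n ↑ʳ l) (base b)) ≈ Γ * sum (λ i → B a i * B b i)
      sum-W-base a b = begin
        sum (λ l → W a l * A (n ↑ʳ l) (base b))
          ≈⟨ sum-W a (λ s → A s (base b)) ⟩
        sum (λ i → - B a i * sum (λ j → rowSums δ N j * A (new i j) (base b)))
          ≈⟨ sum-cong-≋ (λ i → begin
               - B a i * sum (λ j → rowSums δ N j * A (new i j) (base b))
                 ≈⟨ *-congˡ (sum-cong-≋ λ j → *-congˡ (lower b i j)) ⟩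
               - B a i * sum (λ j → rowSums δ N j * - B b i)
                 ≈⟨ *-congˡ (*-distribʳ-sum (- B b i) (rowSums δ N)) ⟨
               - B a i * (Γ * - B b i)
                 ≈⟨ x∙yz≈y∙xz _ _ _ ⟩
               Γ * (- B a i * - B b i)
                 ≈⟨ *-congˡ (-x*-y≈x*y (B a i) (B b i)) ⟩
               Γ * (B a i * B b i) ∎) ⟩
        sum (λ i → Γ * (B a i * B b i))
          ≈⟨ *-distribˡ-sum Γ (λ i → B a i * B b i) ⟨
        Γ * sum (λ i → B a i * B b i) ∎

    det-pockets : det A ≈ det N ^ k * det (λ a b → A (base a) (base b) + - (Γ * sum (λ i → B a i * B b i)))
    det-pockets = begin
      det A
        ≈⟨ det-schur n A W W-solves ⟩
      det (λ a b → A (base a) (base b) + - sum (λ l → W a l * A (n ↑ʳ l) (base b))) *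
      det (λ s t → A (n ↑ʳ s) (n ↑ʳ t))
        ≈⟨ *-cong (det-cong λ a b → +-congˡ (-‿cong (sum-W-base a b)))
                  (det-blockDiagonal k (λ s t → A (n ↑ʳ s) (n ↑ʳ t)) N diag) ⟩
      det (λ a b → A (base a) (base b) + - (Γ * sum (λ i → B a i * B b i))) * det N ^ k
        ≈⟨ *-comm _ _ ⟩
      det N ^ k * det (λ a b → A (base a) (base b) + - (Γ * sum (λ i → B a i * B b i))) ∎

-- Graphs with edge-pockets

↑ˡ≢↑ʳ : ∀ {m n} {i : Fin m} {j : Fin n} → i ↑ˡ n ≢ m ↑ʳ j
↑ˡ≢↑ʳ {m} {n} {i} {j} eq
  with () ← ≡.trans (≡.sym (splitAt-↑ˡ m i n)) (≡.trans (≡.cong (splitAt m) eq) (splitAt-↑ʳ m n j))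

module _ {n} (X : Graph n) where

  open Graph X

  does-true⇒ : ∀ {v w} → does (v ~? w) ≡ true → v ~ w
  does-true⇒ {v} {w} eq with v ~? w
  ... | yes v~w = v~w

  ∈neighbours⇒~ : ∀ {v w} → w ∈ neighbours X v → v ~ w
  ∈neighbours⇒~ {v} {w} w∈ =
    does-true⇒ (≡.trans (≡.sym (lookup∘tabulate (λ w → does (v ~? w)) w)) ([]=⇒lookup w∈))

  -- A missed vertex would make the neighbourhood a proper subset of the complement of v, which has
  -- n - 1 elements.
  maxDegree⇒dominating : ∀ {v} → degree X v ≡ n ℕ.∸ 1 → ∀ {w} → v ≢ w → v ~ w
  maxDegree⇒dominating {v} degree≡ {w} v≢w with v ~? w
  ... | yes v~w = v~w
  ... | no  v≁w = contradiction degree≡ (ℕ.<⇒≢ (≡.subst (degree X v ℕ.<_) size (p⊂q⇒∣p∣<∣q∣ N⊂)))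
    where
    size : ∣ ∁ ⁅ v ⁆ ∣ ≡ n ℕ.∸ 1
    size = ≡.trans (∣∁p∣≡n∸∣p∣ ⁅ v ⁆) (≡.cong (n ℕ.∸_) (∣⁅x⁆∣≡1 v))
    N⊂ : neighbours X v ⊂ ∁ ⁅ v ⁆
    N⊂ = (λ x∈ → x∉p⇒x∈∁p λ x∈v → ~-irr (≡.sym (x∈⁅y⁆⇒x≡y v x∈v)) (∈neighbours⇒~ x∈))
       , w , x∉p⇒x∈∁p (λ w∈v → v≢w (≡.sym (x∈⁅y⁆⇒x≡y v w∈v))) , v≁w ∘ ∈neighbours⇒~

module _ {n} {X : Graph n} (e : Edge X) where

  open Edge e

  end⇒joins : ∀ {v w} → v ≢ w → v EndOf e → w EndOf e → Joins e v w
  end⇒joins v≢w (inj₁ s≡v) (inj₁ s≡w) = contradiction (≡.trans (≡.sym s≡v) s≡w) v≢w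
  end⇒joins v≢w (inj₁ s≡v) (inj₂ t≡w) = inj₁ (s≡v , t≡w)
  end⇒joins v≢w (inj₂ t≡v) (inj₁ s≡w) = inj₂ (s≡w , t≡v)
  end⇒joins v≢w (inj₂ t≡v) (inj₂ t≡w) = contradiction (≡.trans (≡.sym t≡v) t≡w) v≢w

  joins⇒end : ∀ {v w} → Joins e v w → v EndOf e
  joins⇒end = Sum.map proj₁ proj₂

  end⇒∃joins : ∀ {v} → v EndOf e → ∃ (Joins e v)
  end⇒∃joins (inj₁ s≡v) = target , inj₁ (s≡v , ≡.refl)
  end⇒∃joins (inj₂ t≡v) = source , inj₂ (≡.refl , t≡v)

  joins-functional : ∀ {v w z} → Joins e v w → Joins e v z → w ≡ z
  joins-functional (inj₁ (s≡v , t≡w)) (inj₁ (_ , t≡z))   = ≡.trans (≡.sym t≡w) t≡z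
  joins-functional (inj₁ (s≡v , _))   (inj₂ (_ , t≡v))   = contradiction (≡.trans s≡v (≡.sym t≡v)) (ends-distinct e)
  joins-functional (inj₂ (_ , t≡v))   (inj₁ (s≡v , _))   = contradiction (≡.trans s≡v (≡.sym t≡v)) (ends-distinct e)
  joins-functional (inj₂ (s≡w , _))   (inj₂ (s≡z , _))   = ≡.trans (≡.sym s≡w) s≡z

  joins-sym : ∀ {v w} → Joins e v w → Joins e w v
  joins-sym = Sum.swap

module PocketEdges {n h k} (F : Graph n) (E : Fin k → Edge F) (H : Graph (2 ℕ.+ h)) (uv : Edge H)
  (u-degree : degree H (Edge.source uv) ≡ suc h) (v-degree : degree H (Edge.target uv) ≡ suc h) where

  private
    module F = Graph F
    module H = Graph H
    module G = Graph (edgePocketGraph F E H uv)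
    open Edge using (source; target; adjacent)
    u = source uv
    v = target uv
    u≢v = ends-distinct uv
    H₂ = deleteEnds H uv
    module H₂ = Graph H₂

  open EdgePockets F E H uv using (base; new; rank; paste; baseEdge; pocketEdge)

  other : Fin h → Fin (2 ℕ.+ h)
  other = others u≢v

  u≢other : ∀ j → u ≢ other j
  u≢other j eq = punchInᵢ≢i u _ (≡.sym eq)

  v≢other : ∀ j → v ≢ other j
  v≢other j eq = punchInᵢ≢i (punchOut u≢v) j
    (punchIn-injective u _ _ (≡.trans (≡.sym eq) (≡.sym (punchIn-punchOut u≢v))))

  other-rank : ∀ {w} (u≢w : u ≢ w) (v≢w : v ≢ w) → other (rank u≢w v≢w) ≡ w
  other-rank u≢w v≢w = ≡.trans (≡.cong (punchIn u) (punchIn-punchOut _)) (punchIn-punchOut u≢w)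

  other-injective : ∀ {i j} → other i ≡ other j → i ≡ j
  other-injective eq = punchIn-injective (punchOut u≢v) _ _ (punchIn-injective u _ _ eq)

  paste-u : ∀ i → paste i u ≡ base (source (E i))
  paste-u i with u ≟ u | v ≟ u
  ... | yes _  | _ = ≡.refl
  ... | no u≢u | _ = contradiction ≡.refl u≢u

  paste-v : ∀ i → paste i v ≡ base (target (E i))
  paste-v i with u ≟ v | v ≟ v
  ... | yes u≡v | _      = contradiction u≡v u≢v
  ... | no _    | yes _  = ≡.refl
  ... | no _    | no v≢v = contradiction ≡.refl v≢v

  paste-other : ∀ i j → paste i (other j) ≡ new i j
  paste-other i j with u ≟ other j | v ≟ other j
  ... | yes u≡ | _      = contradiction u≡ (u≢other j)
  ... | no _   | yes v≡ = contradiction v≡ (v≢other j)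
  ... | no u≢  | no v≢  = ≡.cong (new i) (other-injective (other-rank u≢ v≢))

  base-injective : ∀ {a b} → base a ≡ base b → a ≡ b
  base-injective = ↑ˡ-injective (k ℕ.* h) _ _

  new-injective : ∀ {i j i′ j′} → new i j ≡ new i′ j′ → i ≡ i′ × j ≡ j′
  new-injective eq = combine-injective _ _ _ _ (↑ʳ-injective n _ _ eq)

  base≢new : ∀ {a i j} → base a ≢ new i j
  base≢new = ↑ˡ≢↑ʳ

  paste≡base : ∀ {i w a} → paste i w ≡ base a → (w ≡ u × source (E i) ≡ a) ⊎ (w ≡ v × target (E i) ≡ a)
  paste≡base {i} {w} eq with u ≟ w | v ≟ w
  ... | yes u≡w | _       = inj₁ (≡.sym u≡w , base-injective eq)
  ... | no _    | yes v≡w = inj₂ (≡.sym v≡w , base-injective eq)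
  ... | no _    | no _    = contradiction (≡.sym eq) base≢new

  paste≡new : ∀ {i w i′ j} → paste i w ≡ new i′ j → i ≡ i′ × w ≡ other j
  paste≡new {i} {w} eq with u ≟ w | v ≟ w
  ... | yes _  | _      = contradiction eq base≢new
  ... | no _   | yes _  = contradiction eq base≢new
  ... | no u≢w | no v≢w =
    Product.map₂ (λ r≡j → ≡.trans (≡.sym (other-rank u≢w v≢w)) (≡.cong other r≡j)) (new-injective eq)

  -- Trades the indices of an edge for equations, so that an edge between prescribed vertices can be
  -- analysed through the preimages under `base` and `paste`.
  G-edge : ∀ {x y} → x G.~ y →
           (∃₂ λ a b → a F.~ b × base a ≡ x × base b ≡ y) ⊎
           (∃ λ i → ∃₂ λ w z → w H.~ z × paste i w ≡ x × paste i z ≡ y)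
  G-edge (baseEdge a~b)     = inj₁ (_ , _ , a~b , ≡.refl , ≡.refl)
  G-edge (pocketEdge i w~z) = inj₂ (i , _ , _ , w~z , ≡.refl , ≡.refl)

  -- A pocket could add an edge between old vertices only as the image of `uv`, and that image is an
  -- edge of F already.
  base~base : ∀ {a b} → base a G.~ base b ⇔ a F.~ b
  base~base = mk⇔ to baseEdge
    where
    to : ∀ {a b} → base a G.~ base b → a F.~ b
    to e with G-edge e
    ... | inj₁ (_ , _ , a~b , a≡ , b≡) = ≡.subst₂ F._~_ (base-injective a≡) (base-injective b≡) a~b
    ... | inj₂ (i , _ , _ , w~z , w≡ , z≡) with paste≡base {i} w≡ | paste≡base {i} z≡
    ...   | inj₁ (≡.refl , ≡.refl) | inj₁ (≡.refl , _)      = contradiction w~z (H.~-irr ≡.refl)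
    ...   | inj₁ (≡.refl , ≡.refl) | inj₂ (≡.refl , ≡.refl) = adjacent (E i)
    ...   | inj₂ (≡.refl , ≡.refl) | inj₁ (≡.refl , ≡.refl) = F.~-sym (adjacent (E i))
    ...   | inj₂ (≡.refl , ≡.refl) | inj₂ (≡.refl , _)      = contradiction w~z (H.~-irr ≡.refl)

  -- Here the degree hypotheses on u and v enter: both dominate H, so the ends of an edge are joined
  -- to its whole pocket. This makes the off-diagonal blocks constant on each pocket.
  base~new : ∀ {a i j} → base a G.~ new i j ⇔ a EndOf E i
  base~new = mk⇔ to from
    where
    to : ∀ {a i j} → base a G.~ new i j → a EndOf E i
    to e with G-edge e
    ... | inj₁ (_ , _ , _ , _ , b≡new) = contradiction b≡new base≢new
    ... | inj₂ (i′ , _ , _ , _ , w≡ , z≡) with paste≡new {i′} z≡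
    ...   | ≡.refl , _ = Sum.map proj₂ proj₂ (paste≡base {i′} w≡)
    from : ∀ {a i j} → a EndOf E i → base a G.~ new i j
    from {i = i} {j} (inj₁ ≡.refl) = ≡.subst₂ G._~_ (paste-u i) (paste-other i j)
      (pocketEdge i (maxDegree⇒dominating H u-degree (u≢other j)))
    from {i = i} {j} (inj₂ ≡.refl) = ≡.subst₂ G._~_ (paste-v i) (paste-other i j)
      (pocketEdge i (maxDegree⇒dominating H v-degree (v≢other j)))

  new~new : ∀ {i j i′ j′} → new i j G.~ new i′ j′ ⇔ (i ≡ i′ × j H₂.~ j′)
  new~new = mk⇔ to from
    where
    to : ∀ {i j i′ j′} → new i j G.~ new i′ j′ → i ≡ i′ × j H₂.~ j′
    to e with G-edge e
    ... | inj₁ (_ , _ , _ , a≡new , _) = contradiction a≡new base≢new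
    ... | inj₂ (l , _ , _ , w~z , w≡ , z≡) with paste≡new {l} w≡ | paste≡new {l} z≡
    ...   | ≡.refl , ≡.refl | ≡.refl , ≡.refl = ≡.refl , w~z
    from : ∀ {i j i′ j′} → i ≡ i′ × j H₂.~ j′ → new i j G.~ new i′ j′
    from {i} {j} {_} {j′} (≡.refl , j~j′) =
      ≡.subst₂ G._~_ (paste-other i j) (paste-other i j′) (pocketEdge i j~j′)

-- Signless Laplacians

module _ {n} {X : Graph n} where

  open Edge

  endOf? : ∀ v (e : Edge X) → Dec (v EndOf e)
  endOf? v e = (source e ≟ v) ⊎-dec (target e ≟ v)

  -- Spelled as inside `spanningSubgraph`, so that adjacency there is decided by `any?` of this test
  -- by definition.
  joins? : ∀ (e : Edge X) v w → Dec (Joins e v w)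
  joins? e v w = ((source e ≟ v) ×-dec (target e ≟ w)) ⊎-dec ((source e ≟ w) ×-dec (target e ≟ v))

module SignlessLaplacians {c ℓ} (R : CommutativeRing c ℓ) where

  open CommutativeRing R hiding (zero)
  open Matrices R
  open RawSemiringDefs (Semiring.rawSemiring semiring) using (_^_)
  open RingProperties ring using (-‿distribˡ-*; -‿distribʳ-*)
  open AbelianGroupProperties +-abelianGroup using (⁻¹-∙-comm)
  open SemiringMult semiring using (×1-homo-*)
  open SemiringSum semiring
  open CommutativeSemigroupProperties *-commutativeSemigroup using (x∙yz≈y∙xz)
  open SetoidReasoning setoid
  open Determinants R

  fromℕ-∣∣ : ∀ {n} (f : Fin n → Bool) → fromℕ ∣ tabulate f ∣ ≈ sum (λ i → if f i then 1# else 0#)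
  fromℕ-∣∣ {zero}  f = refl
  fromℕ-∣∣ {suc n} f with f zero
  ... | true  = +-congˡ (fromℕ-∣∣ (f ∘ suc))
  ... | false = trans (fromℕ-∣∣ (f ∘ suc)) (sym (+-identityˡ _))

  fromℕ-degree : ∀ {n} (X : Graph n) v → fromℕ (degree X v) ≈ sum (λ w → ⟦ Graph._~?_ X v w ⟧)
  fromℕ-degree X v = fromℕ-∣∣ (λ w → does (Graph._~?_ X v w))

  adjacency-⟦⟧ : ∀ {n} (X : Graph n) i j → adjacencyMatrix X i j ≈ ⟦ Graph._~?_ X i j ⟧
  adjacency-⟦⟧ X i j with Graph._~?_ X i j
  ... | yes _ = refl
  ... | no _  = refl

  signlessLaplacian-⟦⟧ : ∀ {n} (X : Graph n) i j →
    signlessLaplacian X i j ≈ ⟦ i ≟ j ⟧ * fromℕ (degree X i) + ⟦ Graph._~?_ X i j ⟧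
  signlessLaplacian-⟦⟧ X i j = +-cong (diagonal-⟦⟧ (fromℕ ∘ degree X) i j) (adjacency-⟦⟧ X i j)

  ⟦≟⟧-*-cong : ∀ {n} {f g : Fin n → Carrier} i j → (i ≡ j → f i ≈ g j) →
               ⟦ i ≟ j ⟧ * f i ≈ ⟦ i ≟ j ⟧ * g j
  ⟦≟⟧-*-cong i j eq with i ≟ j
  ... | yes i≡j = *-congˡ (eq i≡j)
  ... | no _    = trans (zeroˡ _) (sym (zeroˡ _))

  signlessLaplacian-sym : ∀ {n} (X : Graph n) i j → signlessLaplacian X i j ≈ signlessLaplacian X j i
  signlessLaplacian-sym X i j = begin
    signlessLaplacian X i j
      ≈⟨ signlessLaplacian-⟦⟧ X i j ⟩
    ⟦ i ≟ j ⟧ * fromℕ (degree X i) + ⟦ i ~? j ⟧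
      ≈⟨ +-cong (trans (⟦≟⟧-*-cong {f = fromℕ ∘ degree X} {g = fromℕ ∘ degree X} i j
                         λ i≡j → reflexive (≡.cong (fromℕ ∘ degree X) i≡j))
                       (*-congʳ (⟦⟧-cong (mk⇔ ≡.sym ≡.sym) (i ≟ j) (j ≟ i))))
                (⟦⟧-cong (mk⇔ ~-sym ~-sym) (i ~? j) (j ~? i)) ⟩
    ⟦ j ≟ i ⟧ * fromℕ (degree X j) + ⟦ j ~? i ⟧
      ≈⟨ signlessLaplacian-⟦⟧ X j i ⟨
    signlessLaplacian X j i ∎
    where open Graph X

  -- The vertex-edge incidence matrix and its Gram matrix

  module _ {n k} {F : Graph n} (E : Fin k → Edge F) where

    incidence : Matrix n k
    incidence v i = ⟦ endOf? v (E i) ⟧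

    -- The two ends are distinct. This is the origin of the shift x - 2: a pocket vertex gains both
    -- ends of its edge as neighbours.
    sum-incidence : ∀ i → sum (λ v → incidence v i) ≈ fromℕ 2
    sum-incidence i = begin
      sum (λ v → incidence v i)
        ≈⟨ sum-cong-≋ (λ v → ⟦⟧-⊎ (s ≟ v) (t ≟ v)
             λ (s≡v , t≡v) → ends-distinct (E i) (≡.trans s≡v (≡.sym t≡v))) ⟩
      sum (λ v → ⟦ s ≟ v ⟧ + ⟦ t ≟ v ⟧)
        ≈⟨ ∑-distrib-+ (λ v → ⟦ s ≟ v ⟧) (λ v → ⟦ t ≟ v ⟧) ⟩
      sum (λ v → ⟦ s ≟ v ⟧) + sum (λ v → ⟦ t ≟ v ⟧)
        ≈⟨ +-cong (sum-⟦≟⟧ s) (sum-⟦≟⟧ t) ⟩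
      1# + 1#
        ≈⟨ +-congˡ (+-identityʳ 1#) ⟨
      fromℕ 2 ∎
      where
      s = Edge.source (E i)
      t = Edge.target (E i)

    module _ (distinct : Distinct E) where

      private
        S = spanningSubgraph E

      -- `Distinct` excludes parallel edges, so at most one term is nonzero.
      sum-joins : ∀ v w → sum (λ i → ⟦ joins? (E i) v w ⟧) ≈ ⟦ Graph._~?_ S v w ⟧
      sum-joins v w = sum-⟦⟧ (λ i → joins? (E i) v w) distinct

      -- Double counting of pairs (w, i) with edge i joining v to w: each neighbour w comes from
      -- exactly one edge, and each edge at v has exactly one other end.
      spanning-degree : ∀ v → fromℕ (degree S v) ≈ sum (λ i → incidence v i)
      spanning-degree v = begin
        fromℕ (degree S v)
          ≈⟨ fromℕ-degree S v ⟩
        sum (λ w → ⟦ Graph._~?_ S v w ⟧)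
          ≈⟨ sum-cong-≋ (λ w → sum-joins v w) ⟨
        sum (λ w → sum (λ i → ⟦ joins? (E i) v w ⟧))
          ≈⟨ ∑-comm (λ w i → ⟦ joins? (E i) v w ⟧) ⟩
        sum (λ i → sum (λ w → ⟦ joins? (E i) v w ⟧))
          ≈⟨ sum-cong-≋ (λ i → sum-⟦⟧ (joins? (E i) v) (joins-functional (E i))) ⟩
        sum (λ i → ⟦ any? (joins? (E i) v) ⟧)
          ≈⟨ sum-cong-≋ (λ i → ⟦⟧-cong
               (mk⇔ (λ (w , J) → joins⇒end (E i) J) (end⇒∃joins (E i)))
               (any? (joins? (E i) v)) (endOf? v (E i))) ⟩
        sum (λ i → incidence v i) ∎

      -- On the diagonal the brackets are idempotent and count the edges at v. Off it, an edge
      -- having both v and w as ends must join them, and at most one edge does.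
      incidence-gram : ∀ v w → sum (λ i → incidence v i * incidence w i) ≈ signlessLaplacian S v w
      incidence-gram v w = trans (gram v w) (sym (signlessLaplacian-⟦⟧ S v w))
        where
        gram : ∀ v w → sum (λ i → incidence v i * incidence w i) ≈
                       ⟦ v ≟ w ⟧ * fromℕ (degree S v) + ⟦ Graph._~?_ S v w ⟧
        gram v w with v ≟ w
        ... | yes ≡.refl = begin
          sum (λ i → incidence v i * incidence v i)
            ≈⟨ sum-cong-≋ (λ i → begin
                 incidence v i * incidence v i
                   ≈⟨ ⟦⟧-× (endOf? v (E i)) (endOf? v (E i)) ⟨
                 ⟦ endOf? v (E i) ×-dec endOf? v (E i) ⟧
                   ≈⟨ ⟦⟧-cong (mk⇔ proj₁ (λ e → e , e)) (endOf? v (E i) ×-dec endOf? v (E i)) (endOf? v (E i)) ⟩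
                 incidence v i ∎) ⟩
          sum (λ i → incidence v i)
            ≈⟨ spanning-degree v ⟨
          fromℕ (degree S v)
            ≈⟨ *-identityˡ _ ⟨
          1# * fromℕ (degree S v)
            ≈⟨ +-identityʳ _ ⟨
          1# * fromℕ (degree S v) + 0#
            ≈⟨ +-congˡ (⟦⟧-false (Graph._~?_ S v v) (Graph.~-irr S ≡.refl)) ⟨
          1# * fromℕ (degree S v) + ⟦ Graph._~?_ S v v ⟧ ∎
        ... | no v≢w = begin
          sum (λ i → incidence v i * incidence w i)
            ≈⟨ sum-cong-≋ (λ i → begin
                 incidence v i * incidence w i
                   ≈⟨ ⟦⟧-× (endOf? v (E i)) (endOf? w (E i)) ⟨
                 ⟦ endOf? v (E i) ×-dec endOf? w (E i) ⟧
                   ≈⟨ ⟦⟧-cong (mk⇔ (uncurry (end⇒joins (E i) v≢w))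
                                   (λ J → joins⇒end (E i) J , joins⇒end (E i) (joins-sym (E i) J)))
                        (endOf? v (E i) ×-dec endOf? w (E i)) (joins? (E i) v w) ⟩
                 ⟦ joins? (E i) v w ⟧ ∎) ⟩
          sum (λ i → ⟦ joins? (E i) v w ⟧)
            ≈⟨ sum-joins v w ⟩
          ⟦ Graph._~?_ S v w ⟧
            ≈⟨ +-identityˡ _ ⟨
          0# + ⟦ Graph._~?_ S v w ⟧
            ≈⟨ +-congʳ (zeroˡ _) ⟨
          0# * fromℕ (degree S v) + ⟦ Graph._~?_ S v w ⟧ ∎

  -- The two corner matrices in M

  -- Used to replace a corner matrix by a formula in the incidence matrix on all p + q vertices,
  -- which vanishes by itself outside the corner.
  scaledCorner-unique : ∀ {p q} c (A : Matrix p p) (B : Matrix (p ℕ.+ q) (p ℕ.+ q)) →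
    (∀ i j → c * A i j ≈ B (i ↑ˡ q) (j ↑ˡ q)) →
    (∀ v j → B v (p ↑ʳ j) ≈ 0#) → (∀ i w → B (p ↑ʳ i) w ≈ 0#) →
    ∀ v w → (c ⊡ corner q A) v w ≈ B v w
  scaledCorner-unique {p} {q} c A B block right below v w with splitAt p v in v≡ | splitAt p w in w≡
  ... | inj₁ i | inj₁ j = trans (block i j)
    (reflexive (≡.cong₂ B (splitAt⁻¹-↑ˡ v≡) (splitAt⁻¹-↑ˡ w≡)))
  ... | inj₁ i | inj₂ j = trans (zeroʳ c) (sym (trans
    (reflexive (≡.cong (B v) (≡.sym (splitAt⁻¹-↑ʳ w≡)))) (right v j)))
  ... | inj₂ i | _      = trans (zeroʳ c) (sym (trans
    (reflexive (≡.cong (λ z → B z w) (≡.sym (splitAt⁻¹-↑ʳ v≡)))) (below i w)))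

  module _ {p q k} {F : Graph (p ℕ.+ q)} (E : Fin k → Edge F)
    (distinct : Distinct E) (endsFirst : EndsComeFirst {p} {q} E) where

    private
      S = spanningSubgraph E
      𝓔 = edgeInduced {p} {q} E

    incidence-last : ∀ j i → incidence E (p ↑ʳ j) i ≈ 0#
    incidence-last j i = ⟦⟧-false (endOf? (p ↑ʳ j) (E i)) λ e →
      ↑ˡ≢↑ʳ (≡.sym (proj₂ (Equivalence.to (endsFirst (p ↑ʳ j)) (i , e))))

    spanning-degree-last : ∀ j → fromℕ (degree S (p ↑ʳ j)) ≈ 0#
    spanning-degree-last j = trans (spanning-degree E distinct (p ↑ʳ j)) (sum-zero (incidence-last j))

    -- 𝓔 and the spanning subgraph differ only by isolated vertices.
    spanning-degree-first : ∀ a → fromℕ (degree S (a ↑ˡ q)) ≈ fromℕ (degree 𝓔 a)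
    spanning-degree-first a = begin
      fromℕ (degree S (a ↑ˡ q))
        ≈⟨ fromℕ-degree S (a ↑ˡ q) ⟩
      sum (λ w → ⟦ Graph._~?_ S (a ↑ˡ q) w ⟧)
        ≈⟨ sum-++ p (λ w → ⟦ Graph._~?_ S (a ↑ˡ q) w ⟧) ⟩
      sum (λ b → ⟦ Graph._~?_ 𝓔 a b ⟧) + sum (λ j → ⟦ Graph._~?_ S (a ↑ˡ q) (p ↑ʳ j) ⟧)
        ≈⟨ +-cong (sym (fromℕ-degree 𝓔 a)) (sum-zero λ j →
             ⟦⟧-false (Graph._~?_ S (a ↑ˡ q) (p ↑ʳ j)) λ (i , J) →
               ↑ˡ≢↑ʳ (≡.sym (proj₂ (Equivalence.to (endsFirst (p ↑ʳ j))
                 (i , joins⇒end (E i) (joins-sym (E i) J)))))) ⟩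
      fromℕ (degree 𝓔 a) + 0#
        ≈⟨ +-identityʳ _ ⟩
      fromℕ (degree 𝓔 a) ∎

    ⟦≟⟧-↑ˡ : ∀ (i j : Fin p) → ⟦ i ≟ j ⟧ ≈ ⟦ i ↑ˡ q ≟ j ↑ˡ q ⟧
    ⟦≟⟧-↑ˡ i j = ⟦⟧-cong (mk⇔ (≡.cong (_↑ˡ q)) (↑ˡ-injective q i j)) (i ≟ j) (i ↑ˡ q ≟ j ↑ˡ q)

    corner-signlessLaplacian : ∀ c v w →
      (c ⊡ corner q (signlessLaplacian 𝓔)) v w ≈ c * sum (λ i → incidence E v i * incidence E w i)
    corner-signlessLaplacian c = scaledCorner-unique c (signlessLaplacian 𝓔) _
      (λ a b → *-congˡ (begin
        signlessLaplacian 𝓔 a b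
          ≈⟨ signlessLaplacian-⟦⟧ 𝓔 a b ⟩
        ⟦ a ≟ b ⟧ * fromℕ (degree 𝓔 a) + ⟦ Graph._~?_ 𝓔 a b ⟧
          ≈⟨ +-congʳ (*-cong (⟦≟⟧-↑ˡ a b) (sym (spanning-degree-first a))) ⟩
        ⟦ a ↑ˡ q ≟ b ↑ˡ q ⟧ * fromℕ (degree S (a ↑ˡ q)) + ⟦ Graph._~?_ S (a ↑ˡ q) (b ↑ˡ q) ⟧
          ≈⟨ signlessLaplacian-⟦⟧ S (a ↑ˡ q) (b ↑ˡ q) ⟨
        signlessLaplacian S (a ↑ˡ q) (b ↑ˡ q)
          ≈⟨ incidence-gram E distinct (a ↑ˡ q) (b ↑ˡ q) ⟨
        sum (λ i → incidence E (a ↑ˡ q) i * incidence E (b ↑ˡ q) i) ∎))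
      (λ v j → trans (*-congˡ (sum-zero λ i → trans (*-congˡ (incidence-last j i)) (zeroʳ _))) (zeroʳ c))
      (λ i w → trans (*-congˡ (sum-zero λ t → trans (*-congʳ (incidence-last i t)) (zeroˡ _))) (zeroʳ c))

    -- The number of pockets at a vertex is r among the first p vertices, by regularity, and 0 among
    -- the others. The right side is the surplus of the degree in G over that in F.
    corner-𝟙 : ∀ {r} h → Regular 𝓔 r → ∀ v w →
      (fromℕ (r ℕ.* h) ⊡ corner q 𝟙) v w ≈ ⟦ v ≟ w ⟧ * (fromℕ h * sum (λ i → incidence E v i))
    corner-𝟙 {r} h regular v w = trans
      (scaledCorner-unique (fromℕ (r ℕ.* h)) 𝟙 (λ v w → ⟦ v ≟ w ⟧ * (fromℕ h * fromℕ (degree S v)))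
        (λ a b → begin
          fromℕ (r ℕ.* h) * 𝟙 a b
            ≈⟨ *-comm _ _ ⟩
          𝟙 a b * fromℕ (r ℕ.* h)
            ≈⟨ *-cong (trans (𝟙-⟦⟧ a b) (⟦≟⟧-↑ˡ a b)) (trans (×1-homo-* r h) (*-comm _ _)) ⟩
          ⟦ a ↑ˡ q ≟ b ↑ˡ q ⟧ * (fromℕ h * fromℕ r)
            ≈⟨ *-congˡ (*-congˡ (trans (spanning-degree-first a) (reflexive (≡.cong fromℕ (regular a))))) ⟨
          ⟦ a ↑ˡ q ≟ b ↑ˡ q ⟧ * (fromℕ h * fromℕ (degree S (a ↑ˡ q))) ∎)
        (λ v j → trans
          (⟦≟⟧-*-cong {f = λ v → fromℕ h * fromℕ (degree S v)} {g = const 0#} v (p ↑ʳ j) λ { ≡.refl → zero-last j })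
          (zeroʳ _))
        (λ i w → trans (*-congˡ (zero-last i)) (zeroʳ _))
        v w)
      (*-congˡ (*-congˡ (spanning-degree E distinct v)))
      where
      zero-last : ∀ j → fromℕ h * fromℕ (degree S (p ↑ʳ j)) ≈ 0#
      zero-last j = trans (*-congˡ (spanning-degree-last j)) (zeroʳ _)

  -- The entries of xI - Q(G); G enters only through adjacency between old and pocket vertices

  module _ {p q k h r : ℕ} (F : Graph (p ℕ.+ q)) (E : Fin k → Edge F) (distinct : Distinct E)
    (endsFirst : EndsComeFirst {p} {q} E) (regular : Regular (edgeInduced {p} {q} E) r)
    (H₂ : Graph h) (G : Graph (p ℕ.+ q ℕ.+ k ℕ.* h))
    (base~base : ∀ {a b} → Graph._~_ G (a ↑ˡ (k ℕ.* h)) (b ↑ˡ (k ℕ.* h)) ⇔ Graph._~_ F a b)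
    (base~new : ∀ {a i j} → Graph._~_ G (a ↑ˡ (k ℕ.* h)) ((p ℕ.+ q) ↑ʳ combine {k} i j) ⇔ a EndOf E i)
    (new~new : ∀ {i j i′ j′} → Graph._~_ G ((p ℕ.+ q) ↑ʳ combine {k} i j) ((p ℕ.+ q) ↑ʳ combine {k} i′ j′) ⇔
                (i ≡ i′ × Graph._~_ H₂ j j′)) where

    private
      n = p ℕ.+ q
      𝓔 = edgeInduced {p} {q} E
      module F = Graph F
      module G = Graph G
      module H₂ = Graph H₂
      B = incidence E

      base : Fin n → Fin (n ℕ.+ k ℕ.* h)
      base = _↑ˡ (k ℕ.* h)

      new : Fin k → Fin h → Fin (n ℕ.+ k ℕ.* h)
      new i j = n ↑ʳ combine i j

    base-injective : ∀ {a b} → base a ≡ base b → a ≡ b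
    base-injective = ↑ˡ-injective (k ℕ.* h) _ _

    new-injective : ∀ {i j i′ j′} → new i j ≡ new i′ j′ → i ≡ i′ × j ≡ j′
    new-injective eq = combine-injective _ _ _ _ (↑ʳ-injective n _ _ eq)

    base≢new : ∀ {a i j} → base a ≢ new i j
    base≢new = ↑ˡ≢↑ʳ

    sum-order : ∀ (f : Fin (n ℕ.+ k ℕ.* h) → Carrier) →
                sum f ≈ sum (λ a → f (base a)) + sum (λ i → sum (λ j → f (new i j)))
    sum-order f = trans (sum-++ n f) (+-congˡ (sum-combine k (λ x → f (n ↑ʳ x))))

    ⟦base~base⟧ : ∀ a b → ⟦ base a G.~? base b ⟧ ≈ ⟦ a F.~? b ⟧
    ⟦base~base⟧ a b = ⟦⟧-cong base~base (base a G.~? base b) (a F.~? b)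

    ⟦base~new⟧ : ∀ a i j → ⟦ base a G.~? new i j ⟧ ≈ B a i
    ⟦base~new⟧ a i j = ⟦⟧-cong base~new (base a G.~? new i j) (endOf? a (E i))

    ⟦new~base⟧ : ∀ a i j → ⟦ new i j G.~? base a ⟧ ≈ B a i
    ⟦new~base⟧ a i j = trans
      (⟦⟧-cong (mk⇔ G.~-sym G.~-sym) (new i j G.~? base a) (base a G.~? new i j)) (⟦base~new⟧ a i j)

    ⟦new~new⟧ : ∀ i j i′ j′ → ⟦ new i j G.~? new i′ j′ ⟧ ≈ ⟦ i ≟ i′ ⟧ * ⟦ j H₂.~? j′ ⟧
    ⟦new~new⟧ i j i′ j′ = trans
      (⟦⟧-cong new~new (new i j G.~? new i′ j′) ((i ≟ i′) ×-dec (j H₂.~? j′)))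
      (⟦⟧-× (i ≟ i′) (j H₂.~? j′))

    -- Each edge of E at a contributes all h vertices of its pocket.
    degree-base : ∀ a → fromℕ (degree G (base a)) ≈ fromℕ (degree F a) + fromℕ h * sum (λ i → B a i)
    degree-base a = begin
      fromℕ (degree G (base a))
        ≈⟨ fromℕ-degree G (base a) ⟩
      sum (λ y → ⟦ base a G.~? y ⟧)
        ≈⟨ sum-order (λ y → ⟦ base a G.~? y ⟧) ⟩
      sum (λ b → ⟦ base a G.~? base b ⟧) + sum (λ i → sum (λ j → ⟦ base a G.~? new i j ⟧))
        ≈⟨ +-cong (sum-cong-≋ λ b → ⟦base~base⟧ a b) (sum-cong-≋ λ i → sum-cong-≋ λ j → ⟦base~new⟧ a i j) ⟩
      sum (λ b → ⟦ a F.~? b ⟧) + sum (λ i → sum {h} (λ j → B a i))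
        ≈⟨ +-cong (sym (fromℕ-degree F a)) (sum-cong-≋ λ i → sum-const h (B a i)) ⟩
      fromℕ (degree F a) + sum (λ i → fromℕ h * B a i)
        ≈⟨ +-congˡ (*-distribˡ-sum (fromℕ h) (λ i → B a i)) ⟨
      fromℕ (degree F a) + fromℕ h * sum (λ i → B a i) ∎
      where
      sum-const : ∀ h x → sum {h} (const x) ≈ fromℕ h * x
      sum-const zero    x = sym (zeroˡ x)
      sum-const (suc h) x = trans (+-cong (sym (*-identityˡ x)) (sum-const h x)) (sym (distribʳ x 1# (fromℕ h)))

    degree-new : ∀ i j → fromℕ (degree G (new i j)) ≈ fromℕ 2 + fromℕ (degree H₂ j)
    degree-new i j = begin
      fromℕ (degree G (new i j))
        ≈⟨ fromℕ-degree G (new i j) ⟩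
      sum (λ y → ⟦ new i j G.~? y ⟧)
        ≈⟨ sum-order (λ y → ⟦ new i j G.~? y ⟧) ⟩
      sum (λ b → ⟦ new i j G.~? base b ⟧) + sum (λ i′ → sum (λ j′ → ⟦ new i j G.~? new i′ j′ ⟧))
        ≈⟨ +-cong (sum-cong-≋ λ b → ⟦new~base⟧ b i j) (sum-cong-≋ λ i′ → begin
             sum (λ j′ → ⟦ new i j G.~? new i′ j′ ⟧)       ≈⟨ sum-cong-≋ (λ j′ → ⟦new~new⟧ i j i′ j′) ⟩
             sum (λ j′ → ⟦ i ≟ i′ ⟧ * ⟦ j H₂.~? j′ ⟧)      ≈⟨ *-distribˡ-sum ⟦ i ≟ i′ ⟧ (λ j′ → ⟦ j H₂.~? j′ ⟧) ⟨
             ⟦ i ≟ i′ ⟧ * sum (λ j′ → ⟦ j H₂.~? j′ ⟧)      ∎) ⟩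
      sum (λ b → B b i) + sum (λ i′ → ⟦ i ≟ i′ ⟧ * sum (λ j′ → ⟦ j H₂.~? j′ ⟧))
        ≈⟨ +-cong (sum-incidence E i) (sum-δ i (const (sum (λ j′ → ⟦ j H₂.~? j′ ⟧)))) ⟩
      fromℕ 2 + sum (λ j′ → ⟦ j H₂.~? j′ ⟧)
        ≈⟨ +-congˡ (fromℕ-degree H₂ j) ⟨
      fromℕ 2 + fromℕ (degree H₂ j) ∎

    Q-base-base : ∀ a b → signlessLaplacian G (base a) (base b) ≈
                  signlessLaplacian F a b + ⟦ a ≟ b ⟧ * (fromℕ h * sum (λ i → B a i))
    Q-base-base a b = begin
      signlessLaplacian G (base a) (base b)
        ≈⟨ signlessLaplacian-⟦⟧ G (base a) (base b) ⟩
      ⟦ base a ≟ base b ⟧ * fromℕ (degree G (base a)) + ⟦ base a G.~? base b ⟧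
        ≈⟨ +-cong (*-cong (⟦⟧-cong (mk⇔ base-injective (≡.cong base)) (base a ≟ base b) (a ≟ b)) (degree-base a))
                  (⟦base~base⟧ a b) ⟩
      ⟦ a ≟ b ⟧ * (fromℕ (degree F a) + e) + ⟦ a F.~? b ⟧
        ≈⟨ +-congʳ (distribˡ _ _ _) ⟩
      ⟦ a ≟ b ⟧ * fromℕ (degree F a) + ⟦ a ≟ b ⟧ * e + ⟦ a F.~? b ⟧
        ≈⟨ trans (+-assoc _ _ _) (trans (+-congˡ (+-comm _ _)) (sym (+-assoc _ _ _))) ⟩
      ⟦ a ≟ b ⟧ * fromℕ (degree F a) + ⟦ a F.~? b ⟧ + ⟦ a ≟ b ⟧ * e
        ≈⟨ +-congʳ (signlessLaplacian-⟦⟧ F a b) ⟨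
      signlessLaplacian F a b + ⟦ a ≟ b ⟧ * e ∎
      where e = fromℕ h * sum (λ i → B a i)

    module _ (x δ : Carrier) where

      private
        y = x - fromℕ 2
        N = y ⊡ 𝟙 ⊟ signlessLaplacian H₂
        A = x ⊡ 𝟙 ⊟ signlessLaplacian G
        Γ = sum (λ j → rowSums δ N j)
        M = signlessLaplacian F ⊞ fromℕ (r ℕ.* h) ⊡ corner q 𝟙 ⊞ Γ ⊡ corner q (signlessLaplacian 𝓔)

      A-off-diagonal : ∀ {s t} → s ≢ t → A s t ≈ - ⟦ s G.~? t ⟧
      A-off-diagonal {s} {t} s≢t = begin
        x * 𝟙 s t + - signlessLaplacian G s t
          ≈⟨ +-cong (*-congˡ (trans (𝟙-⟦⟧ s t) s≟t≈0)) (-‿cong (signlessLaplacian-⟦⟧ G s t)) ⟩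
        x * 0# + - (⟦ s ≟ t ⟧ * fromℕ (degree G s) + ⟦ s G.~? t ⟧)
          ≈⟨ +-cong (zeroʳ x) (-‿cong (+-congʳ (trans (*-congʳ s≟t≈0) (zeroˡ _)))) ⟩
        0# + - (0# + ⟦ s G.~? t ⟧)
          ≈⟨ trans (+-identityˡ _) (-‿cong (+-identityˡ _)) ⟩
        - ⟦ s G.~? t ⟧ ∎
        where
        s≟t≈0 : ⟦ s ≟ t ⟧ ≈ 0#
        s≟t≈0 = ⟦⟧-false (s ≟ t) s≢t

      A-base-new : ∀ a i j → A (base a) (new i j) ≈ - B a i
      A-base-new a i j = trans (A-off-diagonal base≢new) (-‿cong (⟦base~new⟧ a i j))

      A-new-base : ∀ a i j → A (new i j) (base a) ≈ - B a i
      A-new-base a i j = trans (A-off-diagonal (base≢new ∘ ≡.sym)) (-‿cong (⟦new~base⟧ a i j))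

      ⟦new≟new⟧ : ∀ i j i′ j′ → ⟦ new i j ≟ new i′ j′ ⟧ ≈ ⟦ i ≟ i′ ⟧ * ⟦ j ≟ j′ ⟧
      ⟦new≟new⟧ i j i′ j′ = trans
        (⟦⟧-cong (mk⇔ new-injective (λ { (≡.refl , ≡.refl) → ≡.refl }))
          (new i j ≟ new i′ j′) ((i ≟ i′) ×-dec (j ≟ j′)))
        (⟦⟧-× (i ≟ i′) (j ≟ j′))

      -- Each degree inside a pocket exceeds the one in H₂ by 2; absorbing this excess into the
      -- variable replaces x by y.
      A-new-new : ∀ i j i′ j′ → A (new i j) (new i′ j′) ≈ ⟦ i ≟ i′ ⟧ * N j j′
      A-new-new i j i′ j′ = begin
        x * 𝟙 (new i j) (new i′ j′) + - signlessLaplacian G (new i j) (new i′ j′)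
          ≈⟨ +-cong (*-congˡ (trans (𝟙-⟦⟧ (new i j) (new i′ j′)) (⟦new≟new⟧ i j i′ j′)))
                    (-‿cong (trans (signlessLaplacian-⟦⟧ G (new i j) (new i′ j′))
                      (+-cong (*-cong (⟦new≟new⟧ i j i′ j′) (degree-new i j)) (⟦new~new⟧ i j i′ j′)))) ⟩
        x * (α * β) + - (α * β * (fromℕ 2 + d) + α * e)
          ≈⟨ +-cong (x∙yz≈y∙xz x α β) (-‿cong (trans (+-congʳ (*-assoc α β _)) (sym (distribˡ α _ e)))) ⟩
        α * (x * β) + - (α * (β * (fromℕ 2 + d) + e))
          ≈⟨ trans (+-congˡ (-‿distribʳ-* α _)) (sym (distribˡ α _ _)) ⟩
        α * (x * β + - (β * (fromℕ 2 + d) + e))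
          ≈⟨ *-congˡ (begin
               x * β + - (β * (fromℕ 2 + d) + e)
                 ≈⟨ +-congˡ (-‿cong (trans (+-congʳ (distribˡ β (fromℕ 2) d)) (+-assoc _ _ _))) ⟩
               x * β + - (β * fromℕ 2 + (β * d + e))
                 ≈⟨ +-congˡ (⁻¹-∙-comm _ _) ⟨
               x * β + (- (β * fromℕ 2) + - (β * d + e))
                 ≈⟨ +-assoc _ _ _ ⟨
               x * β + - (β * fromℕ 2) + - (β * d + e)
                 ≈⟨ +-congʳ (+-congˡ (trans (-‿cong (*-comm β (fromℕ 2))) (-‿distribˡ-* (fromℕ 2) β))) ⟩
               x * β + - fromℕ 2 * β + - (β * d + e)
                 ≈⟨ +-cong (sym (distribʳ β x (- fromℕ 2))) (-‿cong (sym (signlessLaplacian-⟦⟧ H₂ j j′))) ⟩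
               y * β + - signlessLaplacian H₂ j j′
                 ≈⟨ +-congʳ (*-congˡ (𝟙-⟦⟧ j j′)) ⟨
               N j j′ ∎) ⟩
        α * N j j′ ∎
        where
        α = ⟦ i ≟ i′ ⟧
        β = ⟦ j ≟ j′ ⟧
        d = fromℕ (degree H₂ j)
        e = ⟦ j H₂.~? j′ ⟧

      charPoly-pockets : det N * δ ≈ 1# → charPoly (signlessLaplacian G) x ≈ det N ^ k * charPoly M x
      charPoly-pockets Nδ≈1 = trans
        (det-pockets {k = k} A B N δ Nδ≈1 N-sym A-base-new A-new-base A-new-new)
        (*-congˡ (det-cong complement))
        where
        N-sym : ∀ i j → N i j ≈ N j i
        N-sym i j = +-cong (*-congˡ (𝟙-sym i j)) (-‿cong (signlessLaplacian-sym H₂ i j))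

        complement : ∀ a b → A (base a) (base b) + - (Γ * sum (λ i → B a i * B b i)) ≈ (x ⊡ 𝟙 ⊟ M) a b
        complement a b = begin
          x * 𝟙 (base a) (base b) + - signlessLaplacian G (base a) (base b) + - (Γ * sum (λ i → B a i * B b i))
            ≈⟨ +-assoc _ _ _ ⟩
          x * 𝟙 (base a) (base b) + (- signlessLaplacian G (base a) (base b) + - (Γ * sum (λ i → B a i * B b i)))
            ≈⟨ +-cong (*-congˡ (trans (𝟙-⟦⟧ (base a) (base b)) (trans
                 (⟦⟧-cong (mk⇔ base-injective (≡.cong base)) (base a ≟ base b) (a ≟ b)) (sym (𝟙-⟦⟧ a b)))))
                 (⁻¹-∙-comm _ _) ⟩
          x * 𝟙 a b + - (signlessLaplacian G (base a) (base b) + Γ * sum (λ i → B a i * B b i))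
            ≈⟨ +-congˡ (-‿cong (+-cong
                 (trans (Q-base-base a b) (+-congˡ (sym (corner-𝟙 {q = q} E distinct endsFirst {r} h regular a b))))
                 (sym (corner-signlessLaplacian {q = q} E distinct endsFirst Γ a b)))) ⟩
          x * 𝟙 a b + - M a b ∎

-- Invertibility over the field of fractions

module LeadingCoefficients {c ℓ} (R : CommutativeRing c ℓ) where

  private module R = CommutativeRing R
  open List using ([]; _∷_)
  open Polynomials R
  private module P = CommutativeRing commutativeRing
  open RingProperties R.ring using (-0#≈0#)

  -- a is the coefficient of degree d, possibly zero, and there are none of higher degree.
  infixr 4 _,_
  record Leads (d : ℕ) (a : R.Carrier) (p : Poly) : Set ℓ where
    constructor _,_
    field
      top   : coeff p d R.≈ a
      above : ∀ m → d < m → coeff p m R.≈ R.0#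

  coeff-+ : ∀ p q n → coeff (p + q) n R.≈ coeff p n R.+ coeff q n
  coeff-+ []      q       n       = R.sym (R.+-identityˡ _)
  coeff-+ (a ∷ p) []      n       = R.sym (R.+-identityʳ _)
  coeff-+ (a ∷ p) (b ∷ q) zero    = R.refl
  coeff-+ (a ∷ p) (b ∷ q) (suc n) = coeff-+ p q n

  coeff-neg : ∀ p n → coeff (- p) n R.≈ R.- coeff p n
  coeff-neg []      n       = R.sym -0#≈0#
  coeff-neg (a ∷ p) zero    = R.refl
  coeff-neg (a ∷ p) (suc n) = coeff-neg p n

  coeff-· : ∀ a p n → coeff (a · p) n R.≈ a R.* coeff p n
  coeff-· a []      n       = R.sym (R.zeroʳ a)
  coeff-· a (b ∷ p) zero    = R.refl
  coeff-· a (b ∷ p) (suc n) = coeff-· a p n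

  leads-resp : ∀ {d a b p} → a R.≈ b → Leads d a p → Leads d b p
  leads-resp a≈b (top , above) = R.trans top a≈b , above

  -- Lets the constant entries of Q count as entries of degree at most 1 with coefficient 0, so that
  -- all entries of xI - Q are treated alike.
  leads-raise : ∀ {d e a p} → d < e → Leads d a p → Leads e R.0# p
  leads-raise d<e (_ , above) = above _ d<e , λ m e<m → above m (ℕ.<-trans d<e e<m)

  leads-+ : ∀ {d a b p q} → Leads d a p → Leads d b q → Leads d (a R.+ b) (p + q)
  leads-+ {d} {p = p} {q} (top , above) (top′ , above′) =
    R.trans (coeff-+ p q d) (R.+-cong top top′) ,
    λ m d<m → R.trans (coeff-+ p q m) (R.trans (R.+-cong (above m d<m) (above′ m d<m)) (R.+-identityˡ R.0#))

  leads-neg : ∀ {d a p} → Leads d a p → Leads d (R.- a) (- p)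
  leads-neg {d} {p = p} (top , above) =
    R.trans (coeff-neg p d) (R.-‿cong top) ,
    λ m d<m → R.trans (coeff-neg p m) (R.trans (R.-‿cong (above m d<m)) -0#≈0#)

  leads-· : ∀ {d a p} b → Leads d a p → Leads d (b R.* a) (b · p)
  leads-· {d} {p = p} b (top , above) =
    R.trans (coeff-· b p d) (R.*-congˡ top) ,
    λ m d<m → R.trans (coeff-· b p m) (R.trans (R.*-congˡ (above m d<m)) (R.zeroʳ b))

  leads-0∷ : ∀ {d a p} → Leads d a p → Leads (suc d) a (R.0# ∷ p)
  leads-0∷ (top , above) = top , λ { (suc m) (s≤s d<m) → above m d<m }

  leads-tail : ∀ {d a b p} → Leads (suc d) a (b ∷ p) → Leads d a p
  leads-tail (top , above) = top , λ m d<m → above (suc m) (s≤s d<m)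

  ≈0⇒leads : ∀ {p} d → p ≈ 0# → Leads d R.0# p
  ≈0⇒leads d p≈0 = p≈0 .coeff-≈ d , λ m _ → p≈0 .coeff-≈ m

  leads-* : ∀ {d e a b} p {q} → Leads d a p → Leads e b q → Leads (d ℕ.+ e) (a R.* b) (p * q)
  leads-* {b = b} [] (0≈a , _) _ =
    R.sym (R.trans (R.*-congʳ (R.sym 0≈a)) (R.zeroˡ b)) , λ _ _ → R.refl
  -- In degree 0 the tail of the first factor is the zero polynomial, though possibly a nonempty
  -- list of zeros.
  leads-* {zero} {e} {a} {b} (x ∷ p) {q} (x≈a , above) q-leads = leads-resp
    (R.trans (R.+-identityʳ _) (R.*-congʳ x≈a))
    (leads-+ (leads-· x q-leads) (≈0⇒leads e 0∷p*q≈0))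
    where
    p*q≈0 : p * q ≈ 0#
    p*q≈0 = P.trans (P.*-congʳ {q} {p} {0#} (mk≈ λ m → above (suc m) (s≤s z≤n))) (P.zeroˡ q)
    0∷p*q≈0 : (R.0# ∷ p * q) ≈ 0#
    0∷p*q≈0 .coeff-≈ zero    = R.refl
    0∷p*q≈0 .coeff-≈ (suc m) = p*q≈0 .coeff-≈ m
  -- The part `x · q` has degree at most e, below suc d + e, so the top coefficient comes from the
  -- shifted product alone.
  leads-* {suc d} {e} (x ∷ p) p-leads q-leads = leads-resp (R.+-identityˡ _)
    (leads-+ (leads-raise (s≤s (ℕ.m≤n+m e d)) (leads-· x q-leads))
             (leads-0∷ (leads-* p (leads-tail p-leads) q-leads)))

  leads-const : ∀ a → Leads 0 a (a ∷ [])
  leads-const a = R.refl , λ { (suc m) _ → R.refl }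

  leads-X : Leads 1 R.1# X
  leads-X = leads-0∷ (leads-const R.1#)

-- The proofs needed to form the field of fractions are parameters, so that instantiation yields the
-- field `ℚ⟨x⟩` itself.
module MonicCharacteristicPolynomial {c ℓ} (R : CommutativeRing c ℓ)
  (nontrivial : ¬ (CommutativeRing._≈_ R (CommutativeRing.1# R) (CommutativeRing.0# R)))
  (≈0? : ∀ p → Dec (Polynomials._≈_ R p (Polynomials.0# R)))
  (1≉0 : ¬ (Polynomials._≈_ R (Polynomials.1# R) (Polynomials.0# R)))
  (noZeroDivisors : ∀ p q → Polynomials._≈_ R (Polynomials._*_ R p q) (Polynomials.0# R) →
    Polynomials._≈_ R p (Polynomials.0# R) ⊎ Polynomials._≈_ R q (Polynomials.0# R))
  where

  open LeadingCoefficients R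
  private
    module R = CommutativeRing R
    module P = Polynomials R
    module P′ = CommutativeRing P.commutativeRing
    module Fr = Fractions P.commutativeRing ≈0? 1≉0 noZeroDivisors
    module K = CommutativeRing Fr.commutativeRing
    module MR = Matrices R
    module MK = Matrices Fr.commutativeRing
  open RawSemiringDefs (Semiring.rawSemiring R.semiring) using () renaming (sum to sumᴿ)
  open RawSemiringDefs (Semiring.rawSemiring K.semiring) using (sum)
  open RingProperties R.ring using (-0#≈0#)

  -- A fraction has no coefficients of its own, so a representing polynomial is carried along
  -- through the determinant.
  record Leadsᶠ (d : ℕ) (a : R.Carrier) (x : Fr.Fraction) : Set (c ⊔ ℓ) where
    constructor via
    field
      poly    : P.Poly
      leads   : Leads d a poly
      x≈embed : x Fr.≈ Fr.embed poly

  leadsᶠ-resp : ∀ {d a b x} → a R.≈ b → Leadsᶠ d a x → Leadsᶠ d b x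
  leadsᶠ-resp a≈b (via p l e) = via p (leads-resp a≈b l) e

  leadsᶠ-raise : ∀ {a x} → Leadsᶠ 0 a x → Leadsᶠ 1 R.0# x
  leadsᶠ-raise (via p l e) = via p (leads-raise (s≤s z≤n) l) e

  leadsᶠ-+ : ∀ {d a b x y} → Leadsᶠ d a x → Leadsᶠ d b y → Leadsᶠ d (a R.+ b) (x K.+ y)
  leadsᶠ-+ (via p l e) (via q l′ e′) = via (p P.+ q) (leads-+ l l′) (K.trans (K.+-cong e e′) (Fr.mk≈
    (P′.*-cong (P′.+-cong (P′.*-identityʳ p) (P′.*-identityʳ q)) (P′.sym (P′.*-identityʳ P.1#)))))

  leadsᶠ-* : ∀ {d d′ a b x y} → Leadsᶠ d a x → Leadsᶠ d′ b y → Leadsᶠ (d ℕ.+ d′) (a R.* b) (x K.* y)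
  leadsᶠ-* (via p l e) (via q l′ e′) = via (p P.* q) (leads-* p l l′) (K.trans (K.*-cong e e′) (Fr.mk≈
    (P′.*-congˡ {p P.* q} (P′.sym (P′.*-identityʳ P.1#)))))

  leadsᶠ-neg : ∀ {d a x} → Leadsᶠ d a x → Leadsᶠ d (R.- a) (K.- x)
  leadsᶠ-neg (via p l e) = via (P.- p) (leads-neg l) (K.-‿cong e)

  leadsᶠ-0 : ∀ d → Leadsᶠ d R.0# K.0#
  leadsᶠ-0 d = via P.0# (≈0⇒leads d P′.refl) K.refl

  leadsᶠ-1 : Leadsᶠ 0 R.1# K.1#
  leadsᶠ-1 = via P.1# (leads-const R.1#) K.refl

  leadsᶠ-sum : ∀ {d n} {f : Fin n → R.Carrier} {g : Fin n → Fr.Fraction} →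
               (∀ i → Leadsᶠ d (f i) (g i)) → Leadsᶠ d (sumᴿ f) (sum g)
  leadsᶠ-sum {d} {zero}  l = leadsᶠ-0 d
  leadsᶠ-sum {d} {suc n} l = leadsᶠ-+ (l zero) (leadsᶠ-sum (l ∘ suc))

  leadsᶠ-fromℕ : ∀ n → Leadsᶠ 0 (MR.fromℕ n) (MK.fromℕ n)
  leadsᶠ-fromℕ zero    = leadsᶠ-0 0
  leadsᶠ-fromℕ (suc n) = leadsᶠ-+ leadsᶠ-1 (leadsᶠ-fromℕ n)

  leadsᶠ-sign : ∀ n → Leadsᶠ 0 (MR.sign n) (MK.sign n)
  leadsᶠ-sign zero    = leadsᶠ-1
  leadsᶠ-sign (suc n) = leadsᶠ-* (leadsᶠ-neg leadsᶠ-1) (leadsᶠ-sign n)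

  -- The expansions over R and over its rational functions have the same shape, so leading
  -- coefficients can be taken factor by factor and term by term.
  leadsᶠ-det : ∀ {n} {A : MR.Matrix n n} {B : MK.Matrix n n} →
               (∀ i j → Leadsᶠ 1 (A i j) (B i j)) → Leadsᶠ n (MR.det A) (MK.det B)
  leadsᶠ-det {zero}  l = leadsᶠ-1
  leadsᶠ-det {suc n} l = leadsᶠ-sum {suc n} {suc n} λ j → leadsᶠ-* (leadsᶠ-sign (toℕ j))
    (leadsᶠ-* (l zero j) (leadsᶠ-det λ r s → l (suc r) (punchIn j s)))

  leadsᶠ-𝟙 : ∀ {n} (i j : Fin n) → Leadsᶠ 0 (MR.𝟙 i j) (MK.𝟙 i j)
  leadsᶠ-𝟙 i j with i ≟ j
  ... | yes _ = leadsᶠ-1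
  ... | no _  = leadsᶠ-0 0

  leadsᶠ-signlessLaplacian : ∀ {n} (X : Graph n) i j →
    Leadsᶠ 0 (MR.signlessLaplacian X i j) (MK.signlessLaplacian X i j)
  leadsᶠ-signlessLaplacian X i j = leadsᶠ-+ diagonal adjacency
    where
    diagonal : Leadsᶠ 0 (MR.degreeMatrix X i j) (MK.degreeMatrix X i j)
    diagonal with i ≟ j
    ... | yes _ = leadsᶠ-fromℕ (degree X i)
    ... | no _  = leadsᶠ-0 0
    adjacency : Leadsᶠ 0 (MR.adjacencyMatrix X i j) (MK.adjacencyMatrix X i j)
    adjacency with Graph._~?_ X i j
    ... | yes _ = leadsᶠ-1
    ... | no _  = leadsᶠ-0 0

  -- The coefficients of degree 1 in tI - Q form the identity matrix, whose determinant is 1.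
  charPoly-leads : ∀ {n} (X : Graph n) {t} → Leadsᶠ 1 R.1# t →
                   Leadsᶠ n R.1# (MK.charPoly (MK.signlessLaplacian X) t)
  charPoly-leads {n} X t-leads = leadsᶠ-resp (Determinants.det-𝟙 R n)
    (leadsᶠ-det λ i j → leadsᶠ-resp
      (R.trans (R.+-cong (R.*-identityˡ _) -0#≈0#) (R.+-identityʳ _))
      (leadsᶠ-+ (leadsᶠ-* t-leads (leadsᶠ-𝟙 i j))
                (leadsᶠ-neg (leadsᶠ-raise (leadsᶠ-signlessLaplacian X i j)))))

  -- Equality of fractions with denominator 1 is equality of polynomials, and comparing coefficients
  -- in degree d would give 1 = 0 in R.
  leadsᶠ-1⇒≉0 : ∀ {d x} → Leadsᶠ d R.1# x → ¬ (x K.≈ K.0#)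
  leadsᶠ-1⇒≉0 {d} (via p (top , above) x≈p) x≈0 = nontrivial
    (R.trans (R.sym top) (P′.trans (P′.sym (P′.*-identityʳ p)) (Fr.cross (K.trans (K.sym x≈p) x≈0)) .P.coeff-≈ d))

  leadsᶠ-x-c : ∀ n → Leadsᶠ 1 R.1# (Fr.embed P.X K.- MK.fromℕ n)
  leadsᶠ-x-c n = leadsᶠ-resp (R.trans (R.+-congˡ -0#≈0#) (R.+-identityʳ R.1#))
    (leadsᶠ-+ (via P.X leads-X K.refl) (leadsᶠ-neg (leadsᶠ-raise (leadsᶠ-fromℕ n))))

  charPoly-invertible : ∀ {n} (X : Graph n) m →
    let d = MK.charPoly (MK.signlessLaplacian X) (Fr.embed P.X K.- MK.fromℕ m) in d K.* d Fr.⁻¹ K.≈ K.1#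
  charPoly-invertible X m = Fr.*-inverseʳ _ (leadsᶠ-1⇒≉0 (charPoly-leads X (leadsᶠ-x-c m)))

open import Defs
open import Data.Nat.Base using (_+_; _∸_) renaming (_*_ to _*ℕ_)
open SignlessLaplacians ℚ⟨x⟩-commutativeRing
open MonicCharacteristicPolynomial ℚ.+-*-commutativeRing ℚ-1≢0
  (ℚ[x].≈0? (ℚ._≟ ℚ.0ℚ)) (ℚ[x].1≉0 ℚ-1≢0) (ℚ[x].noZeroDivisors ℚ-noZeroDivisors)

proposition4p1 :
    ∀ {p q k h r : ℕ} →
    let n = p + q
        m = 2 + h
    in
    (F : Graph n) → 2 ≤ n →
    (E : Fin k → Edge F) → Distinct E →
    EndsComeFirst {p} {q} E →
    Regular (edgeInduced {p} {q} E) r →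
    p *ℕ r ≡ 2 *ℕ k →
    (H : Graph m) → 3 ≤ m →
    (uv : Edge H) →
    degree H (Edge.source uv) ≡ m ∸ 1 →
    degree H (Edge.target uv) ≡ m ∸ 1 →
    let G  = edgePocketGraph F E H uv
        H₂ = deleteEnds H uv
        𝓔  = edgeInduced {p} {q} E
        Q  = λ {s} → signlessLaplacian {s}
        y  = 𝐱 - fromℕ 2
        M  = Q F ⊞ fromℕ (r *ℕ (m ∸ 2)) ⊡ corner q 𝟙 ⊞ coronal (Q H₂) y ⊡ corner q (Q 𝓔)
    in
    charPoly (Q G) 𝐱 ≈ charPoly (Q H₂) y ^ k * charPoly M 𝐱
-- Since m is 2 + h, the terms m ∸ 1 and m ∸ 2 reduce to suc h and h.
proposition4p1 {q = q} {k} {h} {r} F _ E distinct endsFirst regular _ H _ uv u-degree v-degree =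
  charPoly-pockets {q = q} {k} {h} {r} F E distinct endsFirst regular
    H₂ (edgePocketGraph F E H uv) base~base base~new new~new
    -- δ is the very factor by which `inverse` scales the adjugate, so the sum of `rowSums` is the
    -- coronal by definition.
    𝐱 (charPoly (signlessLaplacian H₂) (𝐱 - fromℕ 2) ℚ⟨x⟩.⁻¹) (charPoly-invertible H₂ 2)
  where
  open PocketEdges F E H uv u-degree v-degree
  H₂ = deleteEnds H uv
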